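{- Let $K$ be a number field with ring of integers $\mathcal{O}_K$, and let $I \subseteq \mathcal{O}_K$ be an ideal. Suppose that the ideal class group $Cl(K)$ is cyclic of order $h$. Then there exist $\gamma \in \mathcal{O}_K$, distinct ideals $T_1, \dots, T_m$ of $\mathcal{O}_K$, and non-negative integers $c_1, \dots, c_m$ with $c_1 + \cdots + c_m \le h-1$, such that $$I = (\gamma)\, T_1^{c_1} \cdots T_m^{c_m},$$ where for each $i$, either $T_i$ is a non-principal prime ideal or $T_i = \mathcal{O}_K$.
   Context: $(\gamma)$ denotes the principal ideal of $\mathcal{O}_K$ generated by $\gamma$. For an ideal $T$, $T^0 = \mathcal{O}_K$. -}

module Defs where

open import Algebra.Apartness.Bundles using (HeytingCommutativeRing; HeytingField)
open import Algebra.Bundles using (CommutativeMonoid; CommutativeRing; RawMonoid)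
open import Algebra.Morphism.Structures using (IsMonoidIsomorphism; IsRingHomomorphism)
import Algebra.Properties.Semiring.Sum as Sum
open import Data.Fin.Base using (Fin; zero; suc; toℕ; fromℕ<)
open import Data.Fin.Properties using (toℕ-fromℕ<; toℕ≤pred[n]; toℕ<n)
open import Data.Integer.Base as ℤ using (ℤ; +_)
import Data.Integer.Divisibility as ℤ
import Data.Integer.Properties as ℤ
open import Data.List.Base as List using (List; []; _∷_)
open import Data.List.Membership.Propositional using () renaming (_∈_ to _∈ₗ_)
open import Data.List.Membership.Propositional.Properties
  using (∈-cartesianProductWith⁺; ∈-cartesianProductWith⁻; ∈-tabulate⁺; ∈-tabulate⁻)
open import Data.List.Relation.Unary.Any using (here; there)
open import Data.Nat.Base as ℕ using (ℕ; zero; suc; z≤n; s≤s)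
import Data.Nat.Properties as ℕ
open import Data.Product.Base using (Σ-syntax; ∃; ∃-syntax; _×_; _,_; proj₁; proj₂; swap)
open import Data.Rational.Base as ℚ using (ℚ)
import Data.Rational.Properties as ℚ
import Data.Rational.Unnormalised.Base as ℚᵘ
import Data.Rational.Unnormalised.Properties as ℚᵘ
open import Data.Sum.Base using (_⊎_; inj₁; inj₂)
open import Function.Base using (_∘_; _on_)
open import Level using (Level; _⊔_; 0ℓ) renaming (suc to lsuc)
open import Relation.Binary.Core using (Rel)
open import Relation.Binary.Structures using (IsEquivalence)
import Relation.Binary.Construct.On as On
import Relation.Binary.PropositionalEquality as ≡
open import Relation.Nullary.Negation using (¬_)
open import Relation.Unary using (Pred; _∈_; _⊆_; _≐_)

private
  variable
    c ℓ ℓ₁ ℓ₂ : Level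

-- Equality on ℤ makes this the additive group ℤ/hℤ.
ℤ/_ : ℕ → RawMonoid 0ℓ 0ℓ
ℤ/ h = record
  { Carrier = ℤ
  ; _≈_     = λ i j → + h ℤ.∣ i ℤ.- j
  ; _∙_     = ℤ._+_
  ; ε       = ℤ.0ℤ
  }

-- A monoid isomorphism with a group makes its target a group, and is then
-- a group isomorphism.  For h = 0 the group ℤ/0 is infinite, hence NonZero.
IsCyclicOfOrder : RawMonoid c ℓ → ℕ → Set (c ⊔ ℓ)
IsCyclicOfOrder M h =
  ℕ.NonZero h × ∃[ f ] IsMonoidIsomorphism (ℤ/ h) M f

module Ideals (R : CommutativeRing c ℓ) where
  open CommutativeRing R
  open import Algebra.Properties.CommutativeSemigroup *-commutativeSemigroup
    using (interchange)

  record Ideal : Set (lsuc (c ⊔ ℓ)) where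
    field
      member   : Pred Carrier (c ⊔ ℓ)
      resp-≈   : ∀ {x y} → x ≈ y → x ∈ member → y ∈ member
      0∈       : 0# ∈ member
      +-closed : ∀ {x y} → x ∈ member → y ∈ member → (x + y) ∈ member
      *-closed : ∀ r {x} → x ∈ member → (r * x) ∈ member

  open Ideal public

  infix  4 _≋_ _∈ᵢ_
  infixl 7 _·_

  _∈ᵢ_ : Carrier → Ideal → Set (c ⊔ ℓ)
  x ∈ᵢ I = member I x

  _≋_ : Rel Ideal (c ⊔ ℓ)
  I ≋ J = member I ≐ member J

  ⟨_⟩ : Carrier → Ideal
  ⟨ γ ⟩ = record
    { member   = λ x → ∃[ r ] x ≈ r * γ
    ; resp-≈   = λ { x≈y (r , x≈rγ) → r , trans (sym x≈y) x≈rγ }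
    ; 0∈       = 0# , sym (zeroˡ γ)
    ; +-closed = λ { (r , p) (s , q) → r + s , trans (+-cong p q) (sym (distribʳ γ r s)) }
    ; *-closed = λ { t (r , p) → t * r , trans (*-congˡ p) (sym (*-assoc t r γ)) }
    }

  -- The whole ring, as the ideal generated by 1.
  unitIdeal : Ideal
  unitIdeal = ⟨ 1# ⟩

  data Product (I J : Ideal) : Pred Carrier (c ⊔ ℓ) where
    mul  : ∀ {x y} → x ∈ᵢ I → y ∈ᵢ J → Product I J (x * y)
    null : Product I J 0#
    add  : ∀ {x y} → Product I J x → Product I J y → Product I J (x + y)
    resp : ∀ {x y} → x ≈ y → Product I J x → Product I J y

  _·_ : Ideal → Ideal → Ideal
  I · J = record
    { member   = Product I J
    ; resp-≈   = resp
    ; 0∈       = null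
    ; +-closed = add
    ; *-closed = scale
    }
    where
    scale : ∀ r {x} → Product I J x → Product I J (r * x)
    scale r (mul {x} {y} p q) = resp (*-assoc r x y) (mul (*-closed I r p) q)
    scale r null              = resp (sym (zeroʳ r)) null
    scale r (add {x} {y} p q) = resp (sym (distribˡ r x y)) (add (scale r p) (scale r q))
    scale r (resp x≈y p)      = resp (*-congˡ x≈y) (scale r p)

  ·-least : ∀ I J K → (∀ {x y} → x ∈ᵢ I → y ∈ᵢ J → x * y ∈ᵢ K) → Product I J ⊆ member K
  ·-least I J K f (mul p q)  = f p q
  ·-least I J K f null       = 0∈ K
  ·-least I J K f (add p q)  = +-closed K (·-least I J K f p) (·-least I J K f q)
  ·-least I J K f (resp e p) = resp-≈ K e (·-least I J K f p)

  ≋-isEquivalence : IsEquivalence _≋_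
  ≋-isEquivalence = record
    { refl  = (λ z → z) , (λ z → z)
    ; sym   = swap
    ; trans = λ { (f , g) (h , k) → (λ z → h (f z)) , (λ z → g (k z)) }
    }

  ≋-refl : ∀ {I} → I ≋ I
  ≋-refl {I} = IsEquivalence.refl ≋-isEquivalence {I}

  ·-cong : ∀ {I I′ J J′} → I ≋ I′ → J ≋ J′ → I · J ≋ I′ · J′
  ·-cong {I} {I′} {J} {J′} (f , g) (h , k) =
    ·-least I J (I′ · J′) (λ p q → mul (f p) (h q)) ,
    ·-least I′ J′ (I · J) (λ p q → mul (g p) (k q))

  ·-comm-⊆ : ∀ I J → member (I · J) ⊆ member (J · I)
  ·-comm-⊆ I J = ·-least I J (J · I) λ p q → resp (*-comm _ _) (mul q p)

  ·-comm : ∀ I J → I · J ≋ J · I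
  ·-comm I J = ·-comm-⊆ I J , ·-comm-⊆ J I

  -- The conductor {x | xB ⊆ K}, used to bound products of three ideals.
  private
    conductor : Ideal → Ideal → Ideal
    conductor K B = record
      { member   = λ x → ∀ {y} → y ∈ᵢ B → x * y ∈ᵢ K
      ; resp-≈   = λ e f q → resp-≈ K (*-congʳ e) (f q)
      ; 0∈       = λ _ → resp-≈ K (sym (zeroˡ _)) (0∈ K)
      ; +-closed = λ f g q → resp-≈ K (sym (distribʳ _ _ _)) (+-closed K (f q) (g q))
      ; *-closed = λ r f q → resp-≈ K (sym (*-assoc _ _ _)) (*-closed K r (f q))
      }

  ·-assoc-⊆ : ∀ I J K → member ((I · J) · K) ⊆ member (I · (J · K))
  ·-assoc-⊆ I J K = ·-least (I · J) K (I · (J · K))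
    (λ p → ·-least I J (conductor (I · (J · K)) K)
      (λ q r s → resp (sym (*-assoc _ _ _)) (mul q (mul r s))) p)

  ·-assoc : ∀ I J K → (I · J) · K ≋ I · (J · K)
  ·-assoc I J K = ·-assoc-⊆ I J K , λ z →
    ·-comm-⊆ K (I · J) (proj₁ (·-cong (≋-refl {K}) (·-comm J I))
      (·-assoc-⊆ K J I (proj₁ (·-cong (·-comm J K) (≋-refl {I})) (·-comm-⊆ I (J · K) z))))

  ·-identityˡ : ∀ I → unitIdeal · I ≋ I
  ·-identityˡ I =
    ·-least unitIdeal I I (λ { (r , e) q → resp-≈ I (*-congʳ (sym (trans e (*-identityʳ r)))) (*-closed I r q) }) ,
    λ p → resp (*-identityˡ _) (mul (1# , sym (*-identityˡ 1#)) p)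

  idealMonoid : CommutativeMonoid (lsuc (c ⊔ ℓ)) (c ⊔ ℓ)
  idealMonoid = record
    { Carrier = Ideal
    ; _≈_     = _≋_
    ; _∙_     = _·_
    ; ε       = unitIdeal
    ; isCommutativeMonoid = record
      { isMonoid = record
        { isSemigroup = record
          { isMagma = record
          { isEquivalence = ≋-isEquivalence
          ; ∙-cong        = λ {I} {I′} {J} {J′} → ·-cong {I} {I′} {J} {J′}
          }
          ; assoc   = ·-assoc
          }
        ; identity = ·-identityˡ , λ I →
            IsEquivalence.trans ≋-isEquivalence {I · unitIdeal} {unitIdeal · I} {I} (·-comm I unitIdeal) (·-identityˡ I)
        }
      ; comm = ·-comm
      }
    }

  -- The monoid is written multiplicatively, so its n-fold multiple n × I
  -- is the power Iⁿ, and its sum over a finite family is the product.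
  open import Algebra.Definitions.RawMonoid (CommutativeMonoid.rawMonoid idealMonoid) public
    using () renaming (sum to ∏)
  open import Algebra.Definitions.RawMonoid (CommutativeMonoid.rawMonoid idealMonoid)
    using () renaming (_×_ to _times_)

  infixr 8 _^ᵢ_
  _^ᵢ_ : Ideal → ℕ → Ideal
  I ^ᵢ n = n times I

  IsPrincipal : Pred Ideal (c ⊔ ℓ)
  IsPrincipal I = ∃[ γ ] I ≋ ⟨ γ ⟩

  record IsPrime (P : Ideal) : Set (c ⊔ ℓ) where
    field
      proper : ¬ (P ≋ unitIdeal)
      prime  : ∀ {x y} → x * y ∈ᵢ P → x ∈ᵢ P ⊎ y ∈ᵢ P

  NonZeroIdeal : Pred Ideal (c ⊔ ℓ)
  NonZeroIdeal I = ∃[ x ] x ∈ᵢ I × ¬ (x ≈ 0#)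

  ⟨⟩-homo-* : ∀ α β → ⟨ α * β ⟩ ≋ ⟨ α ⟩ · ⟨ β ⟩
  ⟨⟩-homo-* α β =
    (λ { (r , e) → resp (trans (*-assoc r α β) (sym e))
           (mul (r , refl) (1# , sym (*-identityˡ β))) }) ,
    ·-least ⟨ α ⟩ ⟨ β ⟩ ⟨ α * β ⟩
      (λ { (r , e) (s , e′) → r * s , trans (*-cong e e′) (interchange r α s β) })

record IsDomain (R : CommutativeRing c ℓ) : Set (c ⊔ ℓ) where
  open CommutativeRing R
  field
    1≉0       : ¬ (1# ≈ 0#)
    *-nonZero : ∀ {x y} → ¬ (x ≈ 0#) → ¬ (y ≈ 0#) → ¬ (x * y ≈ 0#)

module IdealClasses (R : CommutativeRing c ℓ) (isDomain : IsDomain R) where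
  open CommutativeRing R
  open Ideals R
  open IsDomain isDomain
  private
    module M = CommutativeMonoid idealMonoid
  open import Algebra.Properties.CommutativeSemigroup M.commutativeSemigroup
    using (x∙yz≈y∙xz; interchange)
  open import Relation.Binary.Reasoning.Setoid M.setoid

  infix 4 _∼_
  _∼_ : Rel Ideal (c ⊔ ℓ)
  I ∼ J = ∃[ α ] ∃[ β ] ¬ (α ≈ 0#) × ¬ (β ≈ 0#) × ⟨ α ⟩ · I ≋ ⟨ β ⟩ · J

  ≋⇒∼ : ∀ {I J} → I ≋ J → I ∼ J
  ≋⇒∼ {I} {J} e = 1# , 1# , 1≉0 , 1≉0 , M.∙-congˡ {⟨ 1# ⟩} {I} {J} e

  ∼-isEquivalence : IsEquivalence _∼_
  ∼-isEquivalence = record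
    { refl  = λ {I} → ≋⇒∼ {I} (M.refl {I})
    ; sym   = λ { (α , β , α≉0 , β≉0 , e) → β , α , β≉0 , α≉0 , M.sym {⟨ α ⟩ · _} {⟨ β ⟩ · _} e }
    ; trans = ∼-trans
    }
    where
    ∼-trans : ∀ {I J K} → I ∼ J → J ∼ K → I ∼ K
    ∼-trans {I} {J} {K} (α , β , α≉0 , β≉0 , e) (γ , δ , γ≉0 , δ≉0 , e′) =
      γ * α , β * δ , *-nonZero γ≉0 α≉0 , *-nonZero β≉0 δ≉0 , (begin
        ⟨ γ * α ⟩ · I       ≈⟨ M.∙-congʳ (⟨⟩-homo-* γ α) ⟩
        ⟨ γ ⟩ · ⟨ α ⟩ · I   ≈⟨ M.assoc ⟨ γ ⟩ ⟨ α ⟩ I ⟩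
        ⟨ γ ⟩ · (⟨ α ⟩ · I) ≈⟨ M.∙-congˡ e ⟩
        ⟨ γ ⟩ · (⟨ β ⟩ · J) ≈⟨ x∙yz≈y∙xz ⟨ γ ⟩ ⟨ β ⟩ J ⟩
        ⟨ β ⟩ · (⟨ γ ⟩ · J) ≈⟨ M.∙-congˡ e′ ⟩
        ⟨ β ⟩ · (⟨ δ ⟩ · K) ≈⟨ M.assoc ⟨ β ⟩ ⟨ δ ⟩ K ⟨
        ⟨ β ⟩ · ⟨ δ ⟩ · K   ≈⟨ M.∙-congʳ (⟨⟩-homo-* β δ) ⟨
        ⟨ β * δ ⟩ · K       ∎)

  ∼-cong : ∀ {I I′ J J′} → I ∼ I′ → J ∼ J′ → I · J ∼ I′ · J′
  ∼-cong {I} {I′} {J} {J′} (α , β , α≉0 , β≉0 , e) (γ , δ , γ≉0 , δ≉0 , e′) =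
    α * γ , β * δ , *-nonZero α≉0 γ≉0 , *-nonZero β≉0 δ≉0 , (begin
      ⟨ α * γ ⟩ · (I · J)               ≈⟨ M.∙-congʳ (⟨⟩-homo-* α γ) ⟩
      ⟨ α ⟩ · ⟨ γ ⟩ · (I · J)           ≈⟨ interchange ⟨ α ⟩ ⟨ γ ⟩ I J ⟩
      ⟨ α ⟩ · I · (⟨ γ ⟩ · J)           ≈⟨ M.∙-cong e e′ ⟩
      ⟨ β ⟩ · I′ · (⟨ δ ⟩ · J′)         ≈⟨ interchange ⟨ β ⟩ I′ ⟨ δ ⟩ J′ ⟩
      ⟨ β ⟩ · ⟨ δ ⟩ · (I′ · J′)         ≈⟨ M.∙-congʳ (⟨⟩-homo-* β δ) ⟨
      ⟨ β * δ ⟩ · (I′ · J′)             ∎)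

  -- Multiplication of classes is induced by that of nonzero ideals.  For the
  -- ring of integers of a number field this monoid is the ideal class group.
  idealClassMonoid : CommutativeMonoid (lsuc (c ⊔ ℓ)) (c ⊔ ℓ)
  idealClassMonoid = record
    { Carrier = ∃ NonZeroIdeal
    ; _≈_     = _∼_ on proj₁
    ; _∙_     = λ { (I , x , x∈I , x≉0) (J , y , y∈J , y≉0) →
                    I · J , x * y , mul x∈I y∈J , *-nonZero x≉0 y≉0 }
    ; ε       = unitIdeal , 1# , (1# , sym (*-identityˡ 1#)) , 1≉0
    ; isCommutativeMonoid = record
      { isMonoid = record
        { isSemigroup = record
          { isMagma = record
            { isEquivalence = On.isEquivalence proj₁ ∼-isEquivalence
            ; ∙-cong        = ∼-cong
            }
          ; assoc = λ { (I , _) (J , _) (K , _) → ≋⇒∼ (M.assoc I J K) }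
          }
        ; identity = (λ { (I , _) → ≋⇒∼ (M.identityˡ I) })
                   , (λ { (I , _) → ≋⇒∼ (M.identityʳ I) })
        }
      ; comm = λ { (I , _) (J , _) → ≋⇒∼ (M.comm I J) }
      }
    }

module Integral
  {c′ ℓ′} (R : CommutativeRing c′ ℓ′) (A : CommutativeRing c ℓ)
  (φ : CommutativeRing.Carrier R → CommutativeRing.Carrier A)
  (φ-homo : IsRingHomomorphism (CommutativeRing.rawRing R) (CommutativeRing.rawRing A) φ)
  where

  private
    module R = CommutativeRing R
    module φ = IsRingHomomorphism φ-homo
  open CommutativeRing A hiding (zero)
  open import Algebra.Properties.Semiring.Sum semiring using (sum; sum-cong-≋; *-distribˡ-sum)
  open import Algebra.Properties.Semiring.Exp semiring using (_^_; ^-congˡ)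
  open import Algebra.Properties.Ring ring
    using (-‿distribˡ-*; -1*x≈-x; +-inverseˡ-unique)
  open import Algebra.Properties.CommutativeSemigroup *-commutativeSemigroup
    using (x∙yz≈y∙xz; interchange)
  import Algebra.Properties.CommutativeSemigroup +-commutativeSemigroup as +
  open import Relation.Binary.Reasoning.Setoid setoid

  IsIntegral : Pred Carrier (c′ ⊔ ℓ)
  IsIntegral x = Σ[ n ∈ ℕ ] Σ[ a ∈ (Fin n → R.Carrier) ]
    x ^ n + sum (λ i → φ (a i) * x ^ toℕ i) ≈ 0#

  -- The elements that are polynomials in x over R of degree < n, and those
  -- that are monic of degree n, in Horner form.
  private
    data Low (x : Carrier) : ℕ → Pred Carrier (c′ ⊔ c ⊔ ℓ) where
      nil  : ∀ {z} → z ≈ 0# → Low x 0 z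
      cons : ∀ {n z l} r → Low x n l → z ≈ φ r + x * l → Low x (suc n) z

    data Monic (x : Carrier) : ℕ → Pred Carrier (c′ ⊔ c ⊔ ℓ) where
      nil  : ∀ {z} → z ≈ 1# → Monic x 0 z
      cons : ∀ {n z l} r → Monic x n l → z ≈ φ r + x * l → Monic x (suc n) z

    module _ {x : Carrier} where
      low-resp : ∀ {n y z} → y ≈ z → Low x n y → Low x n z
      low-resp e (nil p)      = nil (trans (sym e) p)
      low-resp e (cons r l p) = cons r l (trans (sym e) p)

      low-null : ∀ n → Low x n 0#
      low-null zero    = nil refl
      low-null (suc n) = cons R.0# (low-null n)
        (sym (trans (+-cong φ.0#-homo (zeroʳ x)) (+-identityˡ 0#)))

      low-shift : ∀ {n l} → Low x n l → Low x (suc n) (x * l)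
      low-shift l = cons R.0# l (sym (trans (+-congʳ φ.0#-homo) (+-identityˡ _)))

      horner-add : ∀ {y z l k} r s → y ≈ φ r + x * l → z ≈ φ s + x * k →
                   y + z ≈ φ (r R.+ s) + x * (l + k)
      horner-add {y} {z} {l} {k} r s p q = begin
        y + z                             ≈⟨ +-cong p q ⟩
        (φ r + x * l) + (φ s + x * k)     ≈⟨ +.interchange _ _ _ _ ⟩
        (φ r + φ s) + (x * l + x * k)     ≈⟨ +-cong (φ.+-homo r s) (distribˡ x l k) ⟨
        φ (r R.+ s) + x * (l + k)         ∎

      horner-scale : ∀ {z l} t r → z ≈ φ r + x * l → φ t * z ≈ φ (t R.* r) + x * (φ t * l)
      horner-scale {z} {l} t r p = begin
        φ t * z                       ≈⟨ *-congˡ p ⟩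
        φ t * (φ r + x * l)           ≈⟨ distribˡ _ _ _ ⟩
        φ t * φ r + φ t * (x * l)     ≈⟨ +-cong (sym (φ.*-homo t r)) (x∙yz≈y∙xz _ _ _) ⟩
        φ (t R.* r) + x * (φ t * l)   ∎

      horner-mul : ∀ {z l} r y → z ≈ φ r + x * l → x * (l * y) + φ r * y ≈ z * y
      horner-mul {z} {l} r y p = begin
        x * (l * y) + φ r * y   ≈⟨ +-comm _ _ ⟩
        φ r * y + x * (l * y)   ≈⟨ +-congˡ (*-assoc x l y) ⟨
        φ r * y + x * l * y     ≈⟨ distribʳ y _ _ ⟨
        (φ r + x * l) * y       ≈⟨ *-congʳ p ⟨
        z * y                   ∎

      low-add : ∀ {n y z} → Low x n y → Low x n z → Low x n (y + z)
      low-add (nil p)      (nil q)      = nil (trans (+-cong p q) (+-identityˡ 0#))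
      low-add (cons r l p) (cons s k q) = cons (r R.+ s) (low-add l k) (horner-add r s p q)

      low-scale : ∀ {n z} t → Low x n z → Low x n (φ t * z)
      low-scale t (nil p)      = nil (trans (*-congˡ p) (zeroʳ _))
      low-scale t (cons r l p) = cons (t R.* r) (low-scale t l) (horner-scale t r p)

      low-neg : ∀ {n z} → Low x n z → Low x n (- z)
      low-neg l = low-resp (trans (*-congʳ (trans (φ.-‿homo R.1#) (-‿cong φ.1#-homo))) (-1*x≈-x _))
                           (low-scale (R.- R.1#) l)

      low-suc : ∀ {n} → Low x n ⊆ Low x (suc n)
      low-suc (nil p)      = low-resp (sym p) (low-null 1)
      low-suc (cons r l p) = cons r (low-suc l) p

      low-raise : ∀ k {n} → Low x n ⊆ Low x (k ℕ.+ n)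
      low-raise zero    l = l
      low-raise (suc k) l = low-suc (low-raise k l)

      monic-resp : ∀ {n y z} → y ≈ z → Monic x n y → Monic x n z
      monic-resp e (nil p)      = nil (trans (sym e) p)
      monic-resp e (cons r l p) = cons r l (trans (sym e) p)

      monic+low : ∀ {n y z} → Monic x n y → Low x n z → Monic x n (y + z)
      monic+low (nil p)      (nil q)      = nil (trans (+-cong p q) (+-identityʳ 1#))
      monic+low (cons r l p) (cons s k q) = cons (r R.+ s) (monic+low l k) (horner-add r s p q)

      monic⇒low : ∀ {n} → Monic x n ⊆ Low x (suc n)
      monic⇒low (nil p) = cons R.1# (nil refl)
        (trans p (sym (trans (+-cong φ.1#-homo (zeroʳ x)) (+-identityʳ 1#))))
      monic⇒low (cons r l p) = cons r (monic⇒low l) p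

      low*low : ∀ {m n y z} → Low x m y → Low x n z → Low x (m ℕ.+ n) (y * z)
      low*low {n = n} (nil p) k = low-resp (sym (trans (*-congʳ p) (zeroˡ _))) (low-null n)
      low*low {suc m} (cons r l p) k = low-resp (horner-mul r _ p)
        (low-add (low-shift (low*low l k)) (low-raise (suc m) (low-scale r k)))

      monic*monic : ∀ {m n y z} → Monic x m y → Monic x n z → Monic x (m ℕ.+ n) (y * z)
      monic*monic (nil p) k = monic-resp (sym (trans (*-congʳ p) (*-identityˡ _))) k
      monic*monic {suc m} {n} {z = z} (cons r l p) k = monic-resp (horner-mul r _ p)
        (monic+low
          (cons R.0# (monic*monic l k) (sym (trans (+-congʳ φ.0#-homo) (+-identityˡ _))))
          (≡.subst (λ i → Low x i (φ r * z)) (ℕ.+-suc m n)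
            (low-raise m (low-scale r (monic⇒low k)))))

      monic*low : ∀ {m n y z} → Monic x m y → Low x n z → Low x (m ℕ.+ n) (y * z)
      monic*low (nil p) k = low-resp (sym (trans (*-congʳ p) (*-identityˡ _))) k
      monic*low {suc m} (cons r l p) k = low-resp (horner-mul r _ p)
        (low-add (low-shift (monic*low l k)) (low-raise (suc m) (low-scale r k)))

      monic⇒coefficients : ∀ {n z} → Monic x n z → Σ[ a ∈ (Fin n → R.Carrier) ]
        z ≈ x ^ n + sum (λ i → φ (a i) * x ^ toℕ i)
      monic⇒coefficients (nil p) = (λ ()) , trans p (sym (+-identityʳ 1#))
      monic⇒coefficients {suc n} {z} (cons {l = l} r k p) with monic⇒coefficients k
      ... | a , e = b , (begin
          z                                    ≈⟨ p ⟩
          φ r + x * l                          ≈⟨ +-congˡ (*-congˡ e) ⟩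
          φ r + x * (x ^ n + sum t)            ≈⟨ +-congˡ (distribˡ x _ _) ⟩
          φ r + (x ^ suc n + x * sum t)        ≈⟨ +.x∙yz≈y∙xz _ _ _ ⟩
          x ^ suc n + (φ r + x * sum t)        ≈⟨ +-congˡ (+-cong (sym (*-identityʳ _)) (*-distribˡ-sum x t)) ⟩
          x ^ suc n + (φ r * 1# + sum (λ i → x * t i))
            ≈⟨ +-congˡ (+-congˡ (sum-cong-≋ (λ i → x∙yz≈y∙xz x (φ (a i)) (x ^ toℕ i)))) ⟩
          x ^ suc n + sum (λ i → φ (b i) * x ^ toℕ i) ∎)
        where
        t : Fin n → Carrier
        t i = φ (a i) * x ^ toℕ i
        b : Fin (suc n) → R.Carrier
        b zero    = r
        b (suc i) = a i

    -- The R-linear span of 1 and ms.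
    data Span (ms : List Carrier) : Pred Carrier (c′ ⊔ c ⊔ ℓ) where
      gen   : ∀ {m} → m ∈ₗ (1# ∷ ms) → Span ms m
      null  : Span ms 0#
      scale : ∀ r {y} → Span ms y → Span ms (φ r * y)
      add   : ∀ {y z} → Span ms y → Span ms z → Span ms (y + z)
      resp  : ∀ {y z} → y ≈ z → Span ms y → Span ms z

    -- The combinations of 1 and ms with coefficients in Low x n.
    data Comb (x : Carrier) (n : ℕ) : List Carrier → Pred Carrier (c′ ⊔ c ⊔ ℓ) where
      nil  : ∀ {z} → Low x n z → Comb x n [] z
      cons : ∀ {m ms z l w} → Low x n l → Comb x n ms w → z ≈ l * m + w → Comb x n (m ∷ ms) z

    module _ {x : Carrier} where
      comb-resp : ∀ {n ms y z} → y ≈ z → Comb x n ms y → Comb x n ms z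
      comb-resp e (nil l)      = nil (low-resp e l)
      comb-resp e (cons l w p) = cons l w (trans (sym e) p)

      comb-tail : ∀ {n m ms z} → Comb x n ms z → Comb x n (m ∷ ms) z
      comb-tail {n} w = cons (low-null n) w (sym (trans (+-congʳ (zeroˡ _)) (+-identityˡ _)))

      comb-null : ∀ {n} ms → Comb x n ms 0#
      comb-null {n} []   = nil (low-null n)
      comb-null (m ∷ ms) = comb-tail (comb-null ms)

      comb-add : ∀ {n ms y z} → Comb x n ms y → Comb x n ms z → Comb x n ms (y + z)
      comb-add (nil l)      (nil k)      = nil (low-add l k)
      comb-add (cons {m = m} l v p) (cons k w q) = cons (low-add l k) (comb-add v w)
        (trans (+-cong p q) (trans (+.interchange _ _ _ _) (+-congʳ (sym (distribʳ m _ _)))))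

      comb-map : ∀ {n n′ ms z} a → (∀ {l} → Low x n l → Low x n′ (a * l)) →
                 Comb x n ms z → Comb x n′ ms (a * z)
      comb-map a f (nil l)      = nil (f l)
      comb-map a f (cons l w p) = cons (f l) (comb-map a f w)
        (trans (*-congˡ p) (trans (distribˡ a _ _) (+-congʳ (sym (*-assoc a _ _)))))

      low-1 : Low x 1 1#
      low-1 = monic⇒low (nil refl)

      comb-1 : ∀ ms → Comb x 1 ms 1#
      comb-1 []       = nil low-1
      comb-1 (m ∷ ms) = comb-tail (comb-1 ms)

      comb-gen : ∀ {m ms} → m ∈ₗ ms → Comb x 1 ms m
      comb-gen {ms = m ∷ ms} (here ≡.refl) =
        cons low-1 (comb-null ms) (sym (trans (+-identityʳ _) (*-identityˡ m)))
      comb-gen (there i) = comb-tail (comb-gen i)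

      span⇒comb : ∀ {ms} → Span ms ⊆ Comb x 1 ms
      span⇒comb {ms} (gen (here ≡.refl)) = comb-1 ms
      span⇒comb      (gen (there i))     = comb-gen i
      span⇒comb {ms} null                = comb-null ms
      span⇒comb      (scale r s)         = comb-map (φ r) (low-scale r) (span⇒comb s)
      span⇒comb      (add s t)           = comb-add (span⇒comb s) (span⇒comb t)
      span⇒comb      (resp e s)          = comb-resp e (span⇒comb s)

      -- Eliminates the generators ms one at a time from the linear system
      -- saying that q times each generator is a combination of them.
      eliminate : ∀ n ms {q} → Monic x n q → (∀ {m} → m ∈ₗ (1# ∷ ms) → Comb x n ms (q * m)) →
                  ∃[ n′ ] ∃[ q′ ] Monic x n′ q′ × q′ ≈ 0#
      eliminate n [] {q} mq eqs with eqs (here ≡.refl)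
      ... | nil l = n , q + - q
                  , monic+low mq (low-neg (low-resp (*-identityʳ q) l))
                  , -‿inverseʳ q
      eliminate n (m ∷ ms) {q} mq eqs with eqs (there (here ≡.refl))
      ... | cons {l = l} {w} ll cw e =
          eliminate (n ℕ.+ n) ms (monic*monic mp mq) λ
            { (here eq) → reduce (eqs (here eq))
            ; (there i) → reduce (eqs (there (there i)))
            }
        where
        p : Carrier
        p = q + - l
        mp : Monic x n p
        mp = monic+low mq (low-neg ll)
        pm≈w : p * m ≈ w
        pm≈w = begin
          (q + - l) * m              ≈⟨ distribʳ m q (- l) ⟩
          q * m + - l * m            ≈⟨ +-cong e (sym (-‿distribˡ-* l m)) ⟩
          l * m + w + - (l * m)      ≈⟨ +.xy∙z≈y∙xz _ _ _ ⟩
          w + (l * m + - (l * m))    ≈⟨ +-congˡ (-‿inverseʳ _) ⟩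
          w + 0#                     ≈⟨ +-identityʳ w ⟩
          w                          ∎
        reduce : ∀ {u} → Comb x n (m ∷ ms) (q * u) → Comb x (n ℕ.+ n) ms (p * q * u)
        reduce {u} (cons {l = k} {v} lk cv e′) = comb-resp eq
          (comb-add (comb-map k (low*low lk) cw) (comb-map p (monic*low mp) cv))
          where
          eq : k * w + p * v ≈ p * q * u
          eq = begin
            k * w + p * v         ≈⟨ +-congʳ (*-congˡ pm≈w) ⟨
            k * (p * m) + p * v   ≈⟨ +-congʳ (x∙yz≈y∙xz k p m) ⟩
            p * (k * m) + p * v   ≈⟨ distribˡ p _ _ ⟨
            p * (k * m + v)       ≈⟨ *-congˡ e′ ⟨
            p * (q * u)           ≈⟨ *-assoc p q u ⟨
            p * q * u             ∎

    Stabilises : List Carrier → Pred Carrier (c′ ⊔ c ⊔ ℓ)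
    Stabilises ms x = ∀ {m} → m ∈ₗ (1# ∷ ms) → Span ms (x * m)

    stabilises⇒integral : ∀ {ms x} → Stabilises ms x → IsIntegral x
    stabilises⇒integral {ms} {x} st
      with eliminate {x} 1 ms {x}
             (cons R.0# (nil refl)
               (sym (trans (+-congʳ φ.0#-homo) (trans (+-identityˡ _) (*-identityʳ x)))))
             (λ i → span⇒comb (st i))
    ... | n , q , mq , q≈0 with monic⇒coefficients mq
    ... | a , e = n , a , trans (sym e) q≈0

    powers : ℕ → Carrier → List Carrier
    powers n x = List.tabulate {n = suc n} (λ i → x ^ toℕ i)

    span-sum : ∀ {ms n} (t : Fin n → Carrier) → (∀ i → Span ms (t i)) → Span ms (sum t)
    span-sum {n = zero}  t f = null
    span-sum {n = suc n} t f = add (f zero) (span-sum (t ∘ suc) (f ∘ suc))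

    span-neg : ∀ {ms y} → Span ms y → Span ms (- y)
    span-neg s = resp (trans (*-congʳ (trans (φ.-‿homo R.1#) (-‿cong φ.1#-homo))) (-1*x≈-x _))
                      (scale (R.- R.1#) s)

    power∈ : ∀ {n} x k → k ℕ.≤ n → x ^ k ∈ₗ powers n x
    power∈ {n} x k k≤n = ≡.subst (λ j → x ^ j ∈ₗ powers n x) (toℕ-fromℕ< (s≤s k≤n))
      (∈-tabulate⁺ {f = λ i → x ^ toℕ i} (fromℕ< (s≤s k≤n)))

    integral⇒stabilises : ∀ {x} ((n , _) : IsIntegral x) → Stabilises (powers n x) x
    integral⇒stabilises {x} (n , a , e) (here ≡.refl) with n in eq
    ... | zero   = resp (sym (trans (sym (*-identityˡ _)) (trans (*-congʳ 1≈0) (zeroˡ _)))) null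
      where
      1≈0 : 1# ≈ 0#
      1≈0 = trans (sym (+-identityʳ 1#)) e
    ... | suc n′ = gen (there (power∈ x 1 (s≤s z≤n)))
    integral⇒stabilises {x} (n , a , e) (there i) with ∈-tabulate⁻ {f = λ j → x ^ toℕ {suc n} j} i
    ... | j , ≡.refl with ℕ.m≤n⇒m<n∨m≡n (toℕ≤pred[n] j)
    ...   | inj₁ j<n = gen (there (power∈ x (suc (toℕ j)) j<n))
    ...   | inj₂ j≡n = resp (sym top) (span-neg (span-sum _ (λ i →
              scale (a i) (gen (there (power∈ x (suc (toℕ i)) (toℕ<n i)))))))
      where
      t : Fin n → Carrier
      t i = φ (a i) * x ^ toℕ i
      top : x * x ^ toℕ j ≈ - sum (λ i → φ (a i) * x ^ suc (toℕ i))
      top = begin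
        x * x ^ toℕ j                              ≡⟨ ≡.cong (λ k → x * x ^ k) j≡n ⟩
        x * x ^ n                                  ≈⟨ +-inverseˡ-unique _ _ (begin
            x * x ^ n + sum (λ i → φ (a i) * x ^ suc (toℕ i))
              ≈⟨ +-congˡ (sum-cong-≋ (λ i → x∙yz≈y∙xz (φ (a i)) x (x ^ toℕ i))) ⟩
            x * x ^ n + sum (λ i → x * t i)        ≈⟨ +-congˡ (*-distribˡ-sum x t) ⟨
            x * x ^ n + x * sum t                  ≈⟨ distribˡ x _ _ ⟨
            x * (x ^ n + sum t)                    ≈⟨ *-congˡ e ⟩
            x * 0#                                 ≈⟨ zeroʳ x ⟩
            0#                                     ∎) ⟩
        - sum (λ i → φ (a i) * x ^ suc (toℕ i))    ∎

    _⊗_ : List Carrier → List Carrier → List Carrier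
    ms ⊗ ns = List.cartesianProductWith _*_ (1# ∷ ms) (1# ∷ ns)

    span-mul : ∀ {ms ns y z} → Span ms y → Span ns z → Span (ms ⊗ ns) (y * z)
    span-mul (gen i) (gen j) = gen (there (∈-cartesianProductWith⁺ _*_ i j))
    span-mul s@(gen _) null        = resp (sym (zeroʳ _)) null
    span-mul s@(gen _) (scale r t) = resp (x∙yz≈y∙xz _ _ _) (scale r (span-mul s t))
    span-mul s@(gen _) (add t u)   = resp (sym (distribˡ _ _ _)) (add (span-mul s t) (span-mul s u))
    span-mul s@(gen _) (resp e t)  = resp (*-congˡ e) (span-mul s t)
    span-mul null        t = resp (sym (zeroˡ _)) null
    span-mul (scale r s) t = resp (sym (*-assoc _ _ _)) (scale r (span-mul s t))
    span-mul (add s u)   t = resp (sym (distribʳ _ _ _)) (add (span-mul s t) (span-mul u t))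
    span-mul (resp e s)  t = resp (*-congʳ e) (span-mul s t)

    stabilises-⊗ : ∀ {ms ns} z →
      (∀ {m n} → m ∈ₗ (1# ∷ ms) → n ∈ₗ (1# ∷ ns) → Span (ms ⊗ ns) (z * (m * n))) →
      Stabilises (ms ⊗ ns) z
    stabilises-⊗ z f (here ≡.refl) =
      resp (*-congˡ (*-identityˡ 1#)) (f (here ≡.refl) (here ≡.refl))
    stabilises-⊗ {ms} {ns} z f (there i)
      with ∈-cartesianProductWith⁻ _*_ (1# ∷ ms) (1# ∷ ns) i
    ... | m , n , j , k , ≡.refl = f j k

  +-integral : ∀ {x y} → IsIntegral x → IsIntegral y → IsIntegral (x + y)
  +-integral {x} {y} p q = stabilises⇒integral (stabilises-⊗ (x + y) λ {m} {n} i j →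
    resp (sym (trans (distribʳ (m * n) x y) (+-cong (sym (*-assoc x m n)) (x∙yz≈y∙xz y m n))))
         (add (span-mul (integral⇒stabilises p i) (gen j))
              (span-mul (gen i) (integral⇒stabilises q j))))

  *-integral : ∀ {x y} → IsIntegral x → IsIntegral y → IsIntegral (x * y)
  *-integral {x} {y} p q = stabilises⇒integral (stabilises-⊗ (x * y) λ {m} {n} i j →
    resp (interchange x m y n)
         (span-mul (integral⇒stabilises p i) (integral⇒stabilises q j)))

  φ-integral : ∀ r → IsIntegral (φ r)
  φ-integral r = 1 , (λ _ → R.- r) , (begin
    φ r * 1# + (φ (R.- r) * 1# + 0#) ≈⟨ +-cong (*-identityʳ _) (trans (+-identityʳ _) (*-identityʳ _)) ⟩
    φ r + φ (R.- r)                  ≈⟨ +-congˡ (φ.-‿homo r) ⟩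
    φ r + - φ r                      ≈⟨ -‿inverseʳ _ ⟩
    0#                               ∎)

  integral-resp : ∀ {x y} → x ≈ y → IsIntegral x → IsIntegral y
  integral-resp x≈y (n , a , e) = n , a , trans
    (sym (+-cong (^-congˡ n x≈y)
      (sum-cong-≋ {n} (λ i → *-congˡ {φ (a i)} (^-congˡ (toℕ i) x≈y))))) e

  0-integral : IsIntegral 0#
  0-integral = integral-resp φ.0#-homo (φ-integral R.0#)

  1-integral : IsIntegral 1#
  1-integral = integral-resp φ.1#-homo (φ-integral R.1#)

  neg-integral : ∀ {x} → IsIntegral x → IsIntegral (- x)
  neg-integral p = integral-resp
    (trans (*-congʳ (trans (φ.-‿homo R.1#) (-‿cong φ.1#-homo))) (-1*x≈-x _))
    (*-integral (φ-integral (R.- R.1#)) p)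

  integralClosure : CommutativeRing (c′ ⊔ c ⊔ ℓ) ℓ
  integralClosure = record
    { Carrier = ∃ IsIntegral
    ; _≈_     = _≈_ on proj₁
    ; _+_     = λ { (x , p) (y , q) → x + y , +-integral p q }
    ; _*_     = λ { (x , p) (y , q) → x * y , *-integral p q }
    ; -_      = λ { (x , p) → - x , neg-integral p }
    ; 0#      = 0# , 0-integral
    ; 1#      = 1# , 1-integral
    ; isCommutativeRing = record
      { isRing = record
        { +-isAbelianGroup = record
          { isGroup = record
            { isMonoid = record
              { isSemigroup = record
                { isMagma = record
                  { isEquivalence = On.isEquivalence proj₁ isEquivalence
                  ; ∙-cong        = +-cong
                  }
                ; assoc = λ _ _ _ → +-assoc _ _ _
                }
              ; identity = (λ _ → +-identityˡ _) , (λ _ → +-identityʳ _)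
              }
            ; inverse = (λ _ → -‿inverseˡ _) , (λ _ → -‿inverseʳ _)
            ; ⁻¹-cong = -‿cong
            }
          ; comm = λ _ _ → +-comm _ _
          }
        ; *-cong     = *-cong
        ; *-assoc    = λ _ _ _ → *-assoc _ _ _
        ; *-identity = (λ _ → *-identityˡ _) , (λ _ → *-identityʳ _)
        ; distrib    = (λ _ _ _ → distribˡ _ _ _) , (λ _ _ _ → distribʳ _ _ _)
        }
      ; *-comm = λ _ _ → *-comm _ _
      }
    }

-- In a HeytingField the invertible elements are those with x # 0#; under
-- excluded middle tightness makes this the same as ¬ (x ≈ 0#).  The generators need not be
-- independent: size bounds the degree over ℚ.
record NumberField c ℓ₁ ℓ₂ : Set (lsuc (c ⊔ ℓ₁ ⊔ ℓ₂)) where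
  field
    heytingField : HeytingField c ℓ₁ ℓ₂

  open HeytingField heytingField public
    using (_#_; #⇒invertible; invertible⇒#; tight; heytingCommutativeRing)
  open HeytingCommutativeRing heytingCommutativeRing public using (commutativeRing)
  open CommutativeRing commutativeRing public

  field
    ι            : ℚ → Carrier
    ι-isRingHomo : IsRingHomomorphism ℚ.+-*-rawRing rawRing ι
    size         : ℕ
    generators   : Fin size → Carrier
    spanning     : ∀ x → Σ[ q ∈ (Fin size → ℚ) ] x ≈ Sum.sum semiring (λ i → ι (q i) * generators i)

private
  fromℤ : ℤ → ℚ
  fromℤ i = i ℚ./ 1

  fromℤ≃ : ∀ i → ℚ.toℚᵘ (fromℤ i) ℚᵘ.≃ ℚᵘ.mkℚᵘ i 0
  fromℤ≃ i = ℚ.toℚᵘ-fromℚᵘ (ℚᵘ.mkℚᵘ i 0)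

  fromℤ-+ : ∀ i j → fromℤ (i ℤ.+ j) ≡.≡ fromℤ i ℚ.+ fromℤ j
  fromℤ-+ i j = ℚ.toℚᵘ-injective (begin
    ℚ.toℚᵘ (fromℤ (i ℤ.+ j))                 ≈⟨ fromℤ≃ (i ℤ.+ j) ⟩
    ℚᵘ.mkℚᵘ (i ℤ.+ j) 0                      ≡⟨ ≡.cong (λ k → ℚᵘ.mkℚᵘ k 0)
                                                  (≡.cong₂ ℤ._+_ (ℤ.*-identityʳ i) (ℤ.*-identityʳ j)) ⟨
    ℚᵘ.mkℚᵘ i 0 ℚᵘ.+ ℚᵘ.mkℚᵘ j 0             ≈⟨ ℚᵘ.+-cong (fromℤ≃ i) (fromℤ≃ j) ⟨
    ℚ.toℚᵘ (fromℤ i) ℚᵘ.+ ℚ.toℚᵘ (fromℤ j)   ≈⟨ ℚ.toℚᵘ-homo-+ (fromℤ i) (fromℤ j) ⟨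
    ℚ.toℚᵘ (fromℤ i ℚ.+ fromℤ j)             ∎)
    where open ℚᵘ.≃-Reasoning

  fromℤ-* : ∀ i j → fromℤ (i ℤ.* j) ≡.≡ fromℤ i ℚ.* fromℤ j
  fromℤ-* i j = ℚ.toℚᵘ-injective (begin
    ℚ.toℚᵘ (fromℤ (i ℤ.* j))                 ≈⟨ fromℤ≃ (i ℤ.* j) ⟩
    ℚᵘ.mkℚᵘ i 0 ℚᵘ.* ℚᵘ.mkℚᵘ j 0             ≈⟨ ℚᵘ.*-cong (fromℤ≃ i) (fromℤ≃ j) ⟨
    ℚ.toℚᵘ (fromℤ i) ℚᵘ.* ℚ.toℚᵘ (fromℤ j)   ≈⟨ ℚ.toℚᵘ-homo-* (fromℤ i) (fromℤ j) ⟨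
    ℚ.toℚᵘ (fromℤ i ℚ.* fromℤ j)             ∎)
    where open ℚᵘ.≃-Reasoning

  fromℤ-neg : ∀ i → fromℤ (ℤ.- i) ≡.≡ ℚ.- fromℤ i
  fromℤ-neg i = ℚ.toℚᵘ-injective (begin
    ℚ.toℚᵘ (fromℤ (ℤ.- i))     ≈⟨ fromℤ≃ (ℤ.- i) ⟩
    ℚᵘ.- ℚᵘ.mkℚᵘ i 0           ≈⟨ ℚᵘ.-‿cong (fromℤ≃ i) ⟨
    ℚᵘ.- ℚ.toℚᵘ (fromℤ i)      ≈⟨ ℚ.toℚᵘ-homo‿- (fromℤ i) ⟨
    ℚ.toℚᵘ (ℚ.- fromℤ i)       ∎)
    where open ℚᵘ.≃-Reasoning

module _ (K : NumberField c ℓ₁ ℓ₂) where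
  open NumberField K
  open import Algebra.Properties.Ring ring using (-0#≈0#)
  private
    module ι = IsRingHomomorphism ι-isRingHomo
    ≡⇒≈ : ∀ {p q} → p ≡.≡ q → ι p ≈ ι q
    ≡⇒≈ ≡.refl = refl

  ℤ→K : ℤ → Carrier
  ℤ→K i = ι (i ℚ./ 1)

  ℤ→K-isRingHomo : IsRingHomomorphism ℤ.+-*-rawRing rawRing ℤ→K
  ℤ→K-isRingHomo = record
    { isSemiringHomomorphism = record
      { isNearSemiringHomomorphism = record
        { +-isMonoidHomomorphism = record
          { isMagmaHomomorphism = record
            { isRelHomomorphism = record { cong = λ { ≡.refl → refl } }
            ; homo = λ i j → trans (≡⇒≈ (fromℤ-+ i j)) (ι.+-homo _ _)
            }
          ; ε-homo = ι.0#-homo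
          }
        ; *-homo = λ i j → trans (≡⇒≈ (fromℤ-* i j)) (ι.*-homo _ _)
        }
      ; 1#-homo = ι.1#-homo
      }
    ; -‿homo = λ i → trans (≡⇒≈ (fromℤ-neg i)) (ι.-‿homo _)
    }

  open Integral ℤ.+-*-commutativeRing commutativeRing ℤ→K ℤ→K-isRingHomo public
    using () renaming (integralClosure to 𝓞)

  𝓞-isDomain : IsDomain 𝓞
  𝓞-isDomain = record
    { 1≉0       = λ 1≈0 → proj₂ (tight _ _) 1≈0 1#0
    ; *-nonZero = λ {(x , _)} {(y , _)} x≉0 y≉0 xy≈0 → x≉0 (proj₁ (tight x 0#) λ x#0 →
        y≉0 (cancel x#0 xy≈0))
    }
    where
    x-0≈x : ∀ x → x - 0# ≈ x
    x-0≈x x = trans (+-congˡ -0#≈0#) (+-identityʳ x)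
    1#0 : 1# # 0#
    1#0 = invertible⇒# (1# , trans (*-identityˡ _) (x-0≈x 1#) , trans (*-identityʳ _) (x-0≈x 1#))
    cancel : ∀ {x y} → x # 0# → x * y ≈ 0# → y ≈ 0#
    cancel {x} {y} x#0 xy≈0 with #⇒invertible x#0
    ... | z , zx≈1 , _ = begin
      y                   ≈⟨ *-identityˡ y ⟨
      1# * y              ≈⟨ *-congʳ zx≈1 ⟨
      z * (x - 0#) * y    ≈⟨ *-congʳ (*-congˡ (x-0≈x x)) ⟩
      z * x * y           ≈⟨ *-assoc z x y ⟩
      z * (x * y)         ≈⟨ *-congˡ xy≈0 ⟩
      z * 0#              ≈⟨ zeroʳ z ⟩
      0#                  ∎
      where open import Relation.Binary.Reasoning.Setoid setoid

  ClassGroup : RawMonoid (lsuc (c ⊔ ℓ₁)) (c ⊔ ℓ₁)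
  ClassGroup = CommutativeMonoid.rawMonoid (IdealClasses.idealClassMonoid 𝓞 𝓞-isDomain)

{-# OPTIONS --safe #-}
module Submission where

-- Since the ideal classes form a group, every nonzero ideal I has a partner J
-- with I·J principal.  This alone yields cancellation, "to contain is to
-- divide", and the ascending chain condition: if U is the union of a chain and
-- U·J = (δ), then δ already lies in C_N·J for some N, and cancelling J gives
-- U ⊆ C_N.  So I is split into primes by Noetherian induction, principal primes
-- being absorbed into γ.  Whenever the list of nonprincipal primes reaches
-- length h, two of its h + 1 prefix products lie in the same class, so the
-- nonempty block between the two prefixes has a principal product, which is
-- absorbed as well.

open import Defs
open import Axiom.ExcludedMiddle using (ExcludedMiddle)
open import Algebra.Bundles using (CommutativeMonoid; CommutativeRing)
import Algebra.Properties.CommutativeMonoid.Sum as MonoidSum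
open import Algebra.Properties.Semiring.Sum using (sum)
open import Algebra.Morphism.Structures using (IsMonoidIsomorphism)
open import Data.Fin.Base as Fin using (Fin)
import Data.Fin.Properties as Fin
import Data.Integer.Base as ℤ
open import Data.Integer.Base using (ℤ; +_)
import Data.Integer.Divisibility as ℤ
import Data.Integer.Divisibility.Signed as Signed
import Data.Integer.DivMod as ℤ
import Data.Integer.Properties as ℤ
open import Data.List.Base using (List; []; _∷_; _++_; foldr; length; take)
import Data.List.Properties as List
open import Data.List.Relation.Unary.All using (All; []; _∷_)
import Data.List.Relation.Unary.All.Properties as All
import Data.Nat.Base as ℕ
open import Data.Nat.Base using (ℕ; _≤_; _<_; _∸_; z≤n; s≤s)
import Data.Nat.Divisibility as ℕ
import Data.Nat.Properties as ℕ
open import Data.Nat.Properties using (+-*-semiring)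
open import Data.Product.Base using (Σ-syntax; ∃; ∃-syntax; _×_; _,_; proj₁; proj₂)
open import Data.Sum.Base using (_⊎_; inj₁; inj₂)
open import Data.Vec.Functional using (updateAt)
open import Data.Vec.Functional.Properties using (updateAt-updates; updateAt-minimal)
open import Function.Base using (_∘_)
open import Function.Definitions using (Injective)
open import Induction.WellFounded using (Acc; acc)
open import Level using (Lift; lift; lower; _⊔_; suc)
open import Relation.Binary.Core using (Rel)
import Relation.Binary.PropositionalEquality as ≡
open import Relation.Binary.PropositionalEquality using (_≡_)
import Relation.Binary.Reasoning.Setoid as SetoidReasoning
open import Relation.Nullary.Decidable.Core using (yes; no; decidable-stable; map′)
open import Relation.Nullary.Negation using (¬_; contradiction)

-- Preliminaries: finite sums, blocks of a list, residues modulo h.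

lowerEM : ∀ {a} b → ExcludedMiddle (a ⊔ b) → ExcludedMiddle a
lowerEM b em {P} = map′ lower lift (em {Lift b P})

module _ {c ℓ} (M : CommutativeMonoid c ℓ) where
  open CommutativeMonoid M
  open MonoidSum M using (sum-remove; sum-cong-≋) renaming (sum to ⨁)
  open import Relation.Binary.Reasoning.Setoid setoid

  -- Serves to raise a single exponent by one, both in the sum of the exponents and in the product
  -- of the powers.
  sum-multiplyAt : ∀ {n} {x} (i : Fin n) {f g : Fin n → Carrier} →
    g i ≈ x ∙ f i → (∀ j → ¬ (j ≡ i) → g j ≈ f j) → ⨁ g ≈ x ∙ ⨁ f
  sum-multiplyAt {ℕ.suc n} {x} i {f} {g} at off = begin
    ⨁ g                                ≈⟨ sum-remove {i = i} g ⟩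
    g i ∙ ⨁ (g ∘ Fin.punchIn i)        ≈⟨ ∙-cong at (sum-cong-≋ λ j → off _ (Fin.punchInᵢ≢i i j)) ⟩
    (x ∙ f i) ∙ ⨁ (f ∘ Fin.punchIn i)  ≈⟨ assoc _ _ _ ⟩
    x ∙ (f i ∙ ⨁ (f ∘ Fin.punchIn i))  ≈⟨ ∙-congˡ (sum-remove {i = i} f) ⟨
    x ∙ ⨁ f                            ∎

-- The block `y ∷ ys` lies between the two prefixes; writing it as a cons records that `i < j` makes
-- it nonempty.
take-block : ∀ {a} {A : Set a} (xs : List A) {i j} → i < j → j ≤ length xs →
  ∃[ y ] ∃[ ys ] ∃[ zs ] take j xs ≡ take i xs ++ y ∷ ys × xs ≡ take i xs ++ (y ∷ ys) ++ zs
take-block (x ∷ xs) {ℕ.zero}  {ℕ.suc j} _ _ =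
  x , take j xs , _ , ≡.refl , ≡.cong (x ∷_) (≡.sym (List.take++drop≡id j xs))
take-block (x ∷ xs) {ℕ.suc i} {ℕ.suc j} (s≤s i<j) (s≤s j≤n) with take-block xs i<j j≤n
... | y , ys , zs , p , q = y , ys , zs , ≡.cong (x ∷_) p , ≡.cong (x ∷_) q

length-dropBlock : ∀ {a} {A : Set a} (xs : List A) y ys zs →
  length (xs ++ zs) < length (xs ++ (y ∷ ys) ++ zs)
length-dropBlock []       y ys zs = s≤s (List.length-++-≤ʳ zs {ys})
length-dropBlock (_ ∷ xs) y ys zs = s≤s (length-dropBlock xs y ys zs)

-- The conclusion is equality in `ℤ/ h`, so remainders can label the elements of that group by a
-- finite set.
%ℕ-injective-mod : ∀ h .{{_ : ℕ.NonZero h}} i j → i ℤ.%ℕ h ≡ j ℤ.%ℕ h → + h ℤ.∣ i ℤ.- j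
%ℕ-injective-mod h i j eq = Signed.∣⇒∣ᵤ (Signed.divides (i ℤ./ℕ h ℤ.- j ℤ./ℕ h) (begin
  i ℤ.- j
    ≡⟨ ≡.cong₂ ℤ._-_ (ℤ.a≡a%ℕn+[a/ℕn]*n i h) (ℤ.a≡a%ℕn+[a/ℕn]*n j h) ⟩
  (+ r i ℤ.+ q i ℤ.* + h) ℤ.- (+ r j ℤ.+ q j ℤ.* + h)
    ≡⟨ ≡.cong (λ k → (+ k ℤ.+ q i ℤ.* + h) ℤ.- (+ r j ℤ.+ q j ℤ.* + h)) eq ⟩
  (+ r j ℤ.+ q i ℤ.* + h) ℤ.- (+ r j ℤ.+ q j ℤ.* + h)
    ≡⟨ solve (+ r j) (q i) (q j) (+ h) ⟩
  (q i ℤ.- q j) ℤ.* + h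
    ∎))
  where
  open ≡.≡-Reasoning
  open import Data.Integer.Tactic.RingSolver using (solve-∀)
  r : ℤ → ℕ
  r k = k ℤ.%ℕ h
  q : ℤ → ℤ
  q k = k ℤ./ℕ h
  solve : ∀ r s t h → (r ℤ.+ s ℤ.* h) ℤ.- (r ℤ.+ t ℤ.* h) ≡ (s ℤ.- t) ℤ.* h
  solve = solve-∀

-- Ideals of a domain: inclusion, products, nonzero ideals.

module IdealArithmetic {c ℓ} (em : ExcludedMiddle (suc (c ⊔ ℓ)))
  (R : CommutativeRing c ℓ) (isDomain : IsDomain R) where

  open CommutativeRing R
  open Ideals R
  open IsDomain isDomain
  open import Algebra.Properties.Ring ring using (x[y-z]≈xy-xz)
  open import Algebra.Properties.Group +-group using (x∙y⁻¹≈ε⇒x≈y; x≈y⇒x∙y⁻¹≈ε)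
  private
    module M = CommutativeMonoid idealMonoid
    module ≋-Reasoning = SetoidReasoning M.setoid
  open import Algebra.Properties.CommutativeSemigroup M.commutativeSemigroup using (x∙yz≈y∙xz)

  em₀ : ExcludedMiddle (c ⊔ ℓ)
  em₀ = lowerEM (suc (c ⊔ ℓ)) em

  -- `IsDomain` speaks only of nonzero elements, so the equality is obtained by refuting its
  -- negation.
  *-cancelˡ : ∀ {x y z} → ¬ (x ≈ 0#) → x * y ≈ x * z → y ≈ z
  *-cancelˡ {x} {y} {z} x≉0 xy≈xz = x∙y⁻¹≈ε⇒x≈y y z
    (decidable-stable (lowerEM (suc (c ⊔ ℓ)) em) λ y-z≉0 →
      *-nonZero x≉0 y-z≉0 (trans (x[y-z]≈xy-xz x y z) (x≈y⇒x∙y⁻¹≈ε xy≈xz)))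

  infix 4 _⊑_ _⊐_
  _⊑_ : Rel Ideal (c ⊔ ℓ)
  I ⊑ J = ∀ {x} → x ∈ᵢ I → x ∈ᵢ J

  -- The larger ideal stands on the left, so that `Acc _⊐_` allows recursion from an ideal to
  -- strictly larger ones.
  _⊐_ : Rel Ideal (c ⊔ ℓ)
  J ⊐ I = I ⊑ J × ¬ (J ⊑ I)

  ·-monoʳ : ∀ I {J K} → J ⊑ K → I · J ⊑ I · K
  ·-monoʳ I {J} {K} s = ·-least I J (I · K) λ p q → mul p (s q)

  ·-monoˡ : ∀ K {I J} → I ⊑ J → I · K ⊑ J · K
  ·-monoˡ K {I} {J} s = ·-least I K (J · K) λ p q → mul (s p) q

  ·-⊑ˡ : ∀ I J → I · J ⊑ I
  ·-⊑ˡ I J = ·-least I J I λ {x} {y} p _ → resp-≈ I (*-comm y x) (*-closed I y p)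

  ·-⊑ʳ : ∀ I J → I · J ⊑ J
  ·-⊑ʳ I J = ·-least I J J λ {x} {y} _ q → *-closed J x q

  γ∈⟨γ⟩ : ∀ γ → γ ∈ᵢ ⟨ γ ⟩
  γ∈⟨γ⟩ γ = 1# , sym (*-identityˡ γ)

  ⟨⟩-least : ∀ I {γ} → γ ∈ᵢ I → ⟨ γ ⟩ ⊑ I
  ⟨⟩-least I γ∈I (r , e) = resp-≈ I (sym e) (*-closed I r γ∈I)

  1∈⇒≋unit : ∀ I → 1# ∈ᵢ I → I ≋ unitIdeal
  1∈⇒≋unit I 1∈I = (λ {x} _ → x , sym (*-identityʳ x)) , ⟨⟩-least I 1∈I

  ⟨⟩-cong : ∀ {α β} → α ≈ β → ⟨ α ⟩ ≋ ⟨ β ⟩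
  ⟨⟩-cong α≈β = (λ { (r , e) → r , trans e (*-congˡ α≈β) })
              , (λ { (r , e) → r , trans e (*-congˡ (sym α≈β)) })

  -- A general element is a finite sum of products, but with a single generator δ factors out of the
  -- whole sum.
  ∈⟨δ⟩·I⁻ : ∀ {δ} I {x} → x ∈ᵢ ⟨ δ ⟩ · I → ∃[ y ] y ∈ᵢ I × x ≈ δ * y
  ∈⟨δ⟩·I⁻ {δ} I (mul {x} {y} (r , e) q) = r * y , *-closed I r q ,
    trans (*-congʳ (trans e (*-comm r δ))) (*-assoc δ r y)
  ∈⟨δ⟩·I⁻ {δ} I null = 0# , 0∈ I , sym (zeroʳ δ)
  ∈⟨δ⟩·I⁻ {δ} I (add p q) with ∈⟨δ⟩·I⁻ I p | ∈⟨δ⟩·I⁻ I q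
  ... | y , y∈I , e | z , z∈I , e′ =
    y + z , +-closed I y∈I z∈I , trans (+-cong e e′) (sym (distribˡ δ y z))
  ∈⟨δ⟩·I⁻ I (resp e p) with ∈⟨δ⟩·I⁻ I p
  ... | y , y∈I , e′ = y , y∈I , trans (sym e) e′

  NonZero-mono : ∀ {I J} → I ⊑ J → NonZeroIdeal I → NonZeroIdeal J
  NonZero-mono s (x , x∈I , x≉0) = x , s x∈I , x≉0

  NonZero-· : ∀ {I J} → NonZeroIdeal I → NonZeroIdeal J → NonZeroIdeal (I · J)
  NonZero-· (x , x∈I , x≉0) (y , y∈J , y≉0) = x * y , mul x∈I y∈J , *-nonZero x≉0 y≉0

  zero-or-nonZero : ∀ I → I ≋ ⟨ 0# ⟩ ⊎ NonZeroIdeal I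
  zero-or-nonZero I with em₀ {NonZeroIdeal I}
  ... | yes nz = inj₂ nz
  ... | no ¬nz = inj₁
    ( (λ {x} x∈I → 0# , trans
        (decidable-stable (lowerEM (suc (c ⊔ ℓ)) em) λ x≉0 → ¬nz (x , x∈I , x≉0)) (sym (zeroʳ 0#)))
    , ⟨⟩-least I (0∈ I))

  -- The zero ideal is principal, generated by 0.
  nonPrincipal⇒nonZero : ∀ {I} → ¬ IsPrincipal I → NonZeroIdeal I
  nonPrincipal⇒nonZero {I} ¬p with zero-or-nonZero I
  ... | inj₁ z  = contradiction (0# , z) ¬p
  ... | inj₂ nz = nz

  ⟨⟩-cancel-⊑ : ∀ {δ} I J → ¬ (δ ≈ 0#) → ⟨ δ ⟩ · I ⊑ ⟨ δ ⟩ · J → I ⊑ J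
  ⟨⟩-cancel-⊑ {δ} I J δ≉0 s x∈I with ∈⟨δ⟩·I⁻ J (s (mul (γ∈⟨γ⟩ δ) x∈I))
  ... | j , j∈J , e = resp-≈ J (sym (*-cancelˡ δ≉0 e)) j∈J

  -- Invertible ideals: cancellation and division.

  -- The fractional ideal (1/δ)J is the inverse of I; keeping the denominator δ separate stays
  -- inside the ring.
  Invertible : Ideal → Set (suc (c ⊔ ℓ))
  Invertible I = ∃[ J ] ∃[ δ ] ¬ (δ ≈ 0#) × I · J ≋ ⟨ δ ⟩

  Invertible-swap : ∀ {I} ((J , _) : Invertible I) → Invertible J
  Invertible-swap {I} (J , δ , δ≉0 , e) =
    I , δ , δ≉0 , M.trans {J · I} {I · J} {⟨ δ ⟩} (M.comm J I) e

  -- Multiplying by the partner J turns I into `⟨ δ ⟩`, which cancels element by element.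
  cancel-⊑ : ∀ {I} → Invertible I → ∀ K L → I · K ⊑ I · L → K ⊑ L
  cancel-⊑ {I} (J , δ , δ≉0 , e) K L s = ⟨⟩-cancel-⊑ K L δ≉0
    (proj₁ (move L) ∘ ·-monoʳ J s ∘ proj₂ (move K))
    where
    open ≋-Reasoning
    move : ∀ L → J · (I · L) ≋ ⟨ δ ⟩ · L
    move L = begin
      J · (I · L) ≈⟨ M.assoc J I L ⟨
      J · I · L   ≈⟨ M.∙-congʳ (M.comm J I) ⟩
      I · J · L   ≈⟨ M.∙-congʳ e ⟩
      ⟨ δ ⟩ · L   ∎

  cancel-≋ : ∀ {I} → Invertible I → ∀ K L → I · K ≋ I · L → K ≋ L
  cancel-≋ inv K L (s , t) = cancel-⊑ inv K L s , cancel-⊑ inv L K t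

  principal-invertible : ∀ {δ} → ¬ (δ ≈ 0#) → Invertible ⟨ δ ⟩
  principal-invertible {δ} δ≉0 = unitIdeal , δ , δ≉0 , M.identityʳ ⟨ δ ⟩

  -- Since α lies in `⟨ β ⟩ · J`, it is a multiple βb; cancelling `⟨ β ⟩` leaves J generated by b.
  quotient-principal : ∀ {α β} J → ¬ (β ≈ 0#) → ⟨ α ⟩ ≋ ⟨ β ⟩ · J → IsPrincipal J
  quotient-principal {α} {β} J β≉0 e with ∈⟨δ⟩·I⁻ J (proj₁ e (γ∈⟨γ⟩ α))
  ... | b , _ , α≈βb = b , cancel-≋ (principal-invertible β≉0) J ⟨ b ⟩ (begin
      ⟨ β ⟩ · J     ≈⟨ e ⟨
      ⟨ α ⟩         ≈⟨ ⟨⟩-cong α≈βb ⟩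
      ⟨ β * b ⟩     ≈⟨ ⟨⟩-homo-* β b ⟩
      ⟨ β ⟩ · ⟨ b ⟩ ∎)
    where open ≋-Reasoning

  -- The quotient is (1/δ)IP′, which consists of ring elements because IP′ is contained in PP′, that
  -- is, in `⟨ δ ⟩`.
  divide : ∀ {I P} → Invertible P → I ⊑ P → ∃[ Q ] I ≋ P · Q
  divide {I} {P} inv@(P′ , δ , δ≉0 , e) I⊑P =
    Q , cancel-≋ (Invertible-swap {P} inv) I (P · Q) (begin
      P′ · I        ≈⟨ M.comm P′ I ⟩
      I · P′        ≈⟨ ⊑δQ , δQ⊑ ⟩
      ⟨ δ ⟩ · Q     ≈⟨ M.∙-congʳ e ⟨
      P · P′ · Q    ≈⟨ M.∙-congʳ (M.comm P P′) ⟩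
      P′ · P · Q    ≈⟨ M.assoc P′ P Q ⟩
      P′ · (P · Q)  ∎)
    where
    open ≋-Reasoning
    Q : Ideal
    Q = record
      { member   = λ x → δ * x ∈ᵢ I · P′
      ; resp-≈   = λ x≈y p → resp (*-congˡ x≈y) p
      ; 0∈       = resp (sym (zeroʳ δ)) null
      ; +-closed = λ p q → resp (sym (distribˡ δ _ _)) (add p q)
      ; *-closed = λ r {x} p → resp
          (trans (sym (*-assoc r δ x)) (trans (*-congʳ (*-comm r δ)) (*-assoc δ r x)))
          (*-closed (I · P′) r p)
      }
    ⊑δQ : I · P′ ⊑ ⟨ δ ⟩ · Q
    ⊑δQ {x} p with proj₁ e (·-monoˡ P′ I⊑P p)
    ... | r , x≈rδ = resp (sym x≈δr) (mul (γ∈⟨γ⟩ δ) (resp x≈δr p))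
      where
      x≈δr : x ≈ δ * r
      x≈δr = trans x≈rδ (*-comm r δ)
    δQ⊑ : ⟨ δ ⟩ · Q ⊑ I · P′
    δQ⊑ p with ∈⟨δ⟩·I⁻ Q p
    ... | y , δy∈ , x≈δy = resp (sym x≈δy) δy∈

  -- If Q were contained in I, which is PQ, cancelling Q would put 1 into P. This makes division by
  -- a proper ideal a step of the Noetherian induction.
  quotient-⊐ : ∀ {I P Q} → ¬ (1# ∈ᵢ P) → Invertible Q → I ≋ P · Q → Q ⊐ I
  quotient-⊐ {I} {P} {Q} 1∉P inv (s , t) = (·-⊑ʳ P Q ∘ s) , λ Q⊑I →
    1∉P (cancel-⊑ inv unitIdeal P
      (·-comm-⊆ P Q ∘ s ∘ Q⊑I ∘ ·-⊑ˡ Q unitIdeal) (γ∈⟨γ⟩ 1#))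

  -- Ascending chains and their unions.

  module _ (C : ℕ → Ideal) (ascending : ∀ n → C n ⊑ C (ℕ.suc n)) where

    chain-mono : ∀ {m n} → m ≤ n → C m ⊑ C n
    chain-mono {n = n} m≤n = go (ℕ.≤⇒≤′ m≤n)
      where
      go : ∀ {m n} → m ℕ.≤′ n → C m ⊑ C n
      go (ℕ.≤′-reflexive ≡.refl) x∈ = x∈
      go (ℕ.≤′-step m≤n)         x∈ = ascending _ (go m≤n x∈)

    ⋃ : Ideal
    ⋃ = record
      { member   = λ x → ∃[ n ] x ∈ᵢ C n
      ; resp-≈   = λ { e (n , p) → n , resp-≈ (C n) e p }
      ; 0∈       = 0 , 0∈ (C 0)
      ; +-closed = λ { (m , p) (n , q) → m ℕ.⊔ n , +-closed (C (m ℕ.⊔ n))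
                       (chain-mono (ℕ.m≤m⊔n m n) p) (chain-mono (ℕ.m≤n⊔m m n) q) }
      ; *-closed = λ { r (n , p) → n , *-closed (C n) r p }
      }

    -- An element of the product involves finitely many terms, and these all fit into one late
    -- enough member of the chain.
    ⋃·⁻ : ∀ J {x} → x ∈ᵢ ⋃ · J → ∃[ n ] x ∈ᵢ C n · J
    ⋃·⁻ J (mul (n , p) q) = n , mul p q
    ⋃·⁻ J null            = 0 , null
    ⋃·⁻ J (add p q) with ⋃·⁻ J p | ⋃·⁻ J q
    ... | m , p′ | n , q′ = m ℕ.⊔ n , add (·-monoˡ J (chain-mono (ℕ.m≤m⊔n m n)) p′)
                                          (·-monoˡ J (chain-mono (ℕ.m≤n⊔m m n)) q′)
    ⋃·⁻ J (resp e p) with ⋃·⁻ J p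
    ... | n , p′ = n , resp e p′

    chain-stabilises : Invertible ⋃ → ∃[ n ] C (ℕ.suc n) ⊑ C n
    chain-stabilises inv@(J , δ , δ≉0 , s , t) with ⋃·⁻ J (t (γ∈⟨γ⟩ δ))
    ... | n , δ∈ = n , λ x∈ →
      cancel-⊑ (Invertible-swap {⋃} inv) ⋃ (C n)
        (·-comm-⊆ (C n) J ∘ ⟨⟩-least (C n · J) δ∈ ∘ s ∘ ·-comm-⊆ J ⋃) (ℕ.suc n , x∈)

  -- Existence of a prime above a proper ideal.

  adjoin : Ideal → Carrier → Ideal
  adjoin I x = record
    { member   = λ z → ∃[ p ] ∃[ r ] p ∈ᵢ I × z ≈ p + r * x
    ; resp-≈   = λ { e (p , r , p∈I , f) → p , r , p∈I , trans (sym e) f }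
    ; 0∈       = 0# , 0# , 0∈ I , sym (trans (+-identityˡ _) (zeroˡ x))
    ; +-closed = λ { (p , r , p∈I , e) (q , s , q∈I , f) → p + q , r + s , +-closed I p∈I q∈I ,
                     trans (+-cong e f) (trans (interchange _ _ _ _) (+-congˡ (sym (distribʳ x r s)))) }
    ; *-closed = λ { t (p , r , p∈I , e) → t * p , t * r , *-closed I t p∈I ,
                     trans (*-congˡ e) (trans (distribˡ t _ _) (+-congˡ (sym (*-assoc t r x)))) }
    }
    where open import Algebra.Properties.CommutativeSemigroup +-commutativeSemigroup using (interchange)

  adjoin-⊒ : ∀ I x → I ⊑ adjoin I x
  adjoin-⊒ I x {z} z∈I = z , 0# , z∈I , sym (trans (+-congˡ (zeroˡ x)) (+-identityʳ z))

  x∈adjoin : ∀ I x → x ∈ᵢ adjoin I x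
  x∈adjoin I x = 0# , 1# , 0∈ I , sym (trans (+-identityˡ _) (*-identityˡ x))

  -- If x is not in P, then 1 = p + rx; multiplying by y writes y as yp + r(xy), and both terms lie
  -- in P.
  maximal⇒prime : ∀ {P} → ¬ (1# ∈ᵢ P) → (∀ {x} → ¬ (x ∈ᵢ P) → 1# ∈ᵢ adjoin P x) → IsPrime P
  maximal⇒prime {P} 1∉P max = record
    { proper = λ { (_ , u⊑P) → 1∉P (u⊑P (γ∈⟨γ⟩ 1#)) }
    ; prime  = prime
    }
    where
    open import Relation.Binary.Reasoning.Setoid setoid
    prime : ∀ {x y} → x * y ∈ᵢ P → x ∈ᵢ P ⊎ y ∈ᵢ P
    prime {x} {y} xy∈P with em₀ {x ∈ᵢ P}
    ... | yes x∈P = inj₁ x∈P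
    ... | no  x∉P with max x∉P
    ... | p , r , p∈P , 1≈p+rx = inj₂ (resp-≈ P (sym (begin
          y                    ≈⟨ *-identityʳ y ⟨
          y * 1#               ≈⟨ *-congˡ 1≈p+rx ⟩
          y * (p + r * x)      ≈⟨ *-comm _ _ ⟩
          (p + r * x) * y      ≈⟨ distribʳ y _ _ ⟩
          p * y + r * x * y    ≈⟨ +-cong (*-comm p y) (*-assoc r x y) ⟩
          y * p + r * (x * y)  ∎))
        (+-closed P (*-closed P y p∈P) (*-closed P r xy∈P)))

  -- Elements are adjoined as long as the ideal stays proper. Accessibility ends the process, and an
  -- ideal that admits no such extension is maximal, hence prime.
  prime⊒ : ∀ {I} → Acc _⊐_ I → ¬ (1# ∈ᵢ I) → ∃[ P ] I ⊑ P × IsPrime P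
  prime⊒ {I} (acc rs) 1∉I with em₀ {∃[ x ] ¬ (x ∈ᵢ I) × ¬ (1# ∈ᵢ adjoin I x)}
  ... | no ¬ext = I , (λ x∈I → x∈I) , maximal⇒prime 1∉I λ {x} x∉I →
        decidable-stable em₀ λ 1∉ → ¬ext (x , x∉I , 1∉)
  ... | yes (x , x∉I , 1∉)
    with prime⊒ {adjoin I x} (rs {adjoin I x} (adjoin-⊒ I x , λ s → x∉I (s (x∈adjoin I x)))) 1∉
  ... | P , s , isPrime = P , (s ∘ adjoin-⊒ I x) , isPrime

  -- Products of lists of primes and grouping of equal factors.

  prod : List Ideal → Ideal
  prod = foldr _·_ unitIdeal

  prod-++ : ∀ Is Js → prod (Is ++ Js) ≋ prod Is · prod Js
  prod-++ []       Js = M.sym {unitIdeal · prod Js} {prod Js} (M.identityˡ (prod Js))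
  prod-++ (I ∷ Is) Js = begin
    I · prod (Is ++ Js)        ≈⟨ M.∙-congˡ (prod-++ Is Js) ⟩
    I · (prod Is · prod Js)    ≈⟨ M.assoc I (prod Is) (prod Js) ⟨
    I · prod Is · prod Js      ∎
    where open ≋-Reasoning

  NonPrincipalPrime : Ideal → Set (c ⊔ ℓ)
  NonPrincipalPrime P = IsPrime P × ¬ IsPrincipal P

  NonZero-prod : ∀ {Ps} → All NonPrincipalPrime Ps → NonZeroIdeal (prod Ps)
  NonZero-prod []                   = 1# , γ∈⟨γ⟩ 1# , 1≉0
  NonZero-prod {P ∷ Ps} ((_ , ¬p) ∷ ps) =
    NonZero-· {P} {prod Ps} (nonPrincipal⇒nonZero {P} ¬p) (NonZero-prod ps)

  Allowed : Ideal → Set (c ⊔ ℓ)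
  Allowed T = NonPrincipalPrime T ⊎ T ≋ unitIdeal

  -- The degree is an exact value rather than a bound, so each further prime adds exactly one.
  record DistinctPowers (I : Ideal) (k : ℕ) : Set (suc (c ⊔ ℓ)) where
    field
      m         : ℕ
      T         : Fin m → Ideal
      e         : Fin m → ℕ
      nonempty  : 1 ≤ m
      injective : Injective _≡_ _≋_ T
      degree    : sum +-*-semiring e ≡ k
      factors   : I ≋ ∏ (λ i → T i ^ᵢ e i)
      allowed   : ∀ i → Allowed (T i)

  collect : ∀ {Ps} → All NonPrincipalPrime Ps → DistinctPowers (prod Ps) (length Ps)
  -- The unit ideal with exponent 0 keeps the family nonempty.
  collect [] = record
    { m = 1 ; T = λ _ → unitIdeal ; e = λ _ → 0
    ; nonempty = s≤s z≤n
    ; injective = λ { {Fin.zero} {Fin.zero} _ → ≡.refl }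
    ; degree = ≡.refl
    ; factors = M.sym {unitIdeal · unitIdeal} {unitIdeal} (M.identityˡ unitIdeal)
    ; allowed = λ _ → inj₂ (M.refl {unitIdeal})
    }
  collect {P ∷ Ps} (p ∷ ps) with collect ps
  ... | record { m = m ; T = T ; e = e ; nonempty = ne ; injective = inj ; degree = deg
               ; factors = fac ; allowed = all }
    -- Distinctness is up to `≋`: P becomes a new base with exponent 1 if it is equivalent to no
    -- `T i`, and otherwise raises the exponent of that `T i`.
    with em₀ {∃[ i ] T i ≋ P}
  ... | no new = record
    { m = ℕ.suc m ; T = T′ ; e = e′
    ; nonempty = s≤s z≤n
    ; injective = inj′
    ; degree = ≡.cong ℕ.suc deg
    ; factors = begin
        P · prod Ps                                    ≈⟨ M.∙-congˡ fac ⟩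
        -- `P ^ᵢ 1` unfolds to `P · unitIdeal`.
        P · ∏ (λ i → T i ^ᵢ e i)                       ≈⟨ M.∙-congʳ (M.identityʳ P) ⟨
        P · unitIdeal · ∏ (λ i → T i ^ᵢ e i)           ∎
    ; allowed = λ { Fin.zero → inj₁ p ; (Fin.suc i) → all i }
    }
    where
    open ≋-Reasoning
    T′ : Fin (ℕ.suc m) → Ideal
    T′ Fin.zero    = P
    T′ (Fin.suc i) = T i
    e′ : Fin (ℕ.suc m) → ℕ
    e′ Fin.zero    = 1
    e′ (Fin.suc i) = e i
    inj′ : Injective _≡_ _≋_ T′
    inj′ {Fin.zero}  {Fin.zero}  _ = ≡.refl
    inj′ {Fin.zero}  {Fin.suc j} q = contradiction (j , M.sym {P} {T j} q) new
    inj′ {Fin.suc i} {Fin.zero}  q = contradiction (i , q) new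
    inj′ {Fin.suc i} {Fin.suc j} q = ≡.cong Fin.suc (inj q)
  ... | yes (i , Ti≋P) = record
    { m = m ; T = T ; e = e′
    ; nonempty = ne
    ; injective = inj
    ; degree = ≡.trans
        (sum-multiplyAt ℕ.+-0-commutativeMonoid {x = 1} i {e} {e′} (updateAt-updates i e)
          λ j j≢i → updateAt-minimal j i e j≢i)
        (≡.cong ℕ.suc deg)
    ; factors = begin
        P · prod Ps                     ≈⟨ M.∙-congˡ fac ⟩
        P · ∏ (λ j → T j ^ᵢ e j)        ≈⟨ sum-multiplyAt idealMonoid {x = P} i
                                             {λ j → T j ^ᵢ e j} {λ j → T j ^ᵢ e′ j} at off ⟨
        ∏ (λ j → T j ^ᵢ e′ j)           ∎
    ; allowed = all
    }
    where
    open ≋-Reasoning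
    e′ : Fin m → ℕ
    e′ = updateAt e i ℕ.suc
    at : T i ^ᵢ e′ i ≋ P · T i ^ᵢ e i
    at = begin
      T i ^ᵢ e′ i            ≡⟨ ≡.cong (T i ^ᵢ_) (updateAt-updates i e) ⟩
      T i · T i ^ᵢ e i       ≈⟨ M.∙-congʳ Ti≋P ⟩
      P · T i ^ᵢ e i         ∎
    off : ∀ j → ¬ (j ≡ i) → T j ^ᵢ e′ j ≋ T j ^ᵢ e j
    off j j≢i = M.reflexive (≡.cong (T j ^ᵢ_) (updateAt-minimal j i e j≢i))

  -- Factorizations with a bounded number of nonprincipal primes.

  -- Primes are listed with multiplicity, γ gathers every principal factor, and k is to become h -
  -- 1.
  record Factorization (k : ℕ) (I : Ideal) : Set (suc (c ⊔ ℓ)) where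
    constructor factorization
    field
      γ       : Carrier
      Ps      : List Ideal
      primes  : All NonPrincipalPrime Ps
      bounded : length Ps ≤ k
      factors : I ≋ ⟨ γ ⟩ · prod Ps

  factorization-prod : ∀ {k} Ps → All NonPrincipalPrime Ps → length Ps ≤ k → Factorization k (prod Ps)
  factorization-prod Ps primes bounded = factorization 1# Ps primes bounded
    (M.sym {unitIdeal · prod Ps} {prod Ps} (M.identityˡ (prod Ps)))

  -- B will be a principal prime, a block of primes with principal product, or a generator split off
  -- earlier.
  absorb : ∀ {k I J B} δ → Factorization k J → B ≋ ⟨ δ ⟩ → I ≋ B · J → Factorization k I
  absorb {I = I} {J} {B} δ (factorization γ Ps primes bounded factors) B≋ I≋ =
    factorization (δ * γ) Ps primes bounded (begin
      I                          ≈⟨ I≋ ⟩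
      B · J                      ≈⟨ M.∙-cong B≋ factors ⟩
      ⟨ δ ⟩ · (⟨ γ ⟩ · prod Ps)  ≈⟨ M.assoc ⟨ δ ⟩ ⟨ γ ⟩ (prod Ps) ⟨
      ⟨ δ ⟩ · ⟨ γ ⟩ · prod Ps    ≈⟨ M.∙-congʳ (⟨⟩-homo-* δ γ) ⟨
      ⟨ δ * γ ⟩ · prod Ps        ∎)
    where open ≋-Reasoning

  -- Noetherian induction when all nonzero ideals are invertible.

  module _ (invertible : ∀ {I} → NonZeroIdeal I → Invertible I) where

    -- Excluded middle here decides Σ-types, so it also provides the choice
    -- function that builds an ascending chain of inaccessible ideals.
    ⊐-accessible : ∀ {I} → NonZeroIdeal I → Acc _⊐_ I
    ⊐-accessible {I} nz = decidable-stable em λ ¬acc → descent ¬acc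
      where
      Bad : Set (suc (c ⊔ ℓ))
      Bad = ∃[ J ] ¬ Acc _⊐_ J
      larger : ((J , _) : Bad) → Σ[ (K , _) ∈ Bad ] K ⊐ J
      larger (J , ¬acc) with em {Σ[ (K , _) ∈ Bad ] K ⊐ J}
      ... | yes found = found
      ... | no  none  = contradiction
        -- With no inaccessible ideal above J, every larger ideal is accessible, hence so is J.
        (acc λ {K} K⊐J → decidable-stable em λ ¬accK → none ((K , ¬accK) , K⊐J)) ¬acc
      descent : ¬ ¬ Acc _⊐_ I
      descent ¬acc = proj₂ (proj₂ (larger (chain n))) stable
        where
        chain : ℕ → Bad
        chain ℕ.zero    = I , ¬acc
        chain (ℕ.suc n) = proj₁ (larger (chain n))
        C : ℕ → Ideal
        C n = proj₁ (chain n)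
        ascending : ∀ n → C n ⊑ C (ℕ.suc n)
        ascending n = proj₁ (proj₂ (larger (chain n)))
        ⋃-nonZero : NonZeroIdeal (⋃ C ascending)
        ⋃-nonZero = NonZero-mono {I} {⋃ C ascending} (λ x∈I → 0 , x∈I) nz
        stabilises : ∃[ n ] C (ℕ.suc n) ⊑ C n
        stabilises = chain-stabilises C ascending (invertible ⋃-nonZero)
        n : ℕ
        n = proj₁ stabilises
        stable : C (ℕ.suc n) ⊑ C n
        stable = proj₂ stabilises

    open IdealClasses R isDomain using (_∼_)

    -- From αI = βJ = βIK, cancelling I gives `⟨ α ⟩` = βK. Here I and J will be prefix products and
    -- K the block between them.
    ∼⇒quotient-principal : ∀ {I J K} → NonZeroIdeal I → I ∼ J → J ≋ I · K → IsPrincipal K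
    ∼⇒quotient-principal {I} {J} {K} nz (α , β , α≉0 , β≉0 , e) J≋IK =
      quotient-principal K β≉0 (cancel-≋ (invertible nz) ⟨ α ⟩ (⟨ β ⟩ · K) (begin
        I · ⟨ α ⟩         ≈⟨ M.comm I ⟨ α ⟩ ⟩
        ⟨ α ⟩ · I         ≈⟨ e ⟩
        ⟨ β ⟩ · J         ≈⟨ M.∙-congˡ J≋IK ⟩
        ⟨ β ⟩ · (I · K)   ≈⟨ x∙yz≈y∙xz ⟨ β ⟩ I K ⟩
        I · (⟨ β ⟩ · K)   ∎))
      where
      open ≋-Reasoning

    -- Pigeonhole on prefix products, with h = `suc k` labels for classes.

    module _ {k} (class : ∃ NonZeroIdeal → Fin (ℕ.suc k))
             (class-injective : ∀ I J → class I ≡ class J → proj₁ I ∼ proj₁ J) where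

      shorten : ∀ Ps → All NonPrincipalPrime Ps → length Ps ≡ ℕ.suc k → Factorization k (prod Ps)
      -- The prefix lengths 0 to `suc k`, with the empty prefix included, are `2 + k` in number, one
      -- more than the labels.
      shorten Ps primes len with Fin.pigeonhole (ℕ.n<1+n _)
        (λ (i : Fin (2 ℕ.+ k)) → class
          (prod (take (Fin.toℕ i) Ps) , NonZero-prod (All.take⁺ (Fin.toℕ i) primes)))
      ... | i , j , i<j , same
        with take-block Ps i<j (≡.subst (Fin.toℕ j ≤_) (≡.sym len) (Fin.toℕ≤pred[n] j))
      ... | Q , Qs , Zs , takeⱼ , split =
        absorb {J = prod (A ++ Zs)} {prod B} b
          (factorization-prod (A ++ Zs) (All.++⁺ (All.take⁺ (Fin.toℕ i) primes) primesZ) short)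
          B≋ (begin
            prod Ps                     ≡⟨ ≡.cong prod split ⟩
            prod (A ++ B ++ Zs)         ≈⟨ prod-++ A (B ++ Zs) ⟩
            prod A · prod (B ++ Zs)     ≈⟨ M.∙-congˡ (prod-++ B Zs) ⟩
            prod A · (prod B · prod Zs) ≈⟨ x∙yz≈y∙xz (prod A) (prod B) (prod Zs) ⟩
            prod B · (prod A · prod Zs) ≈⟨ M.∙-congˡ (prod-++ A Zs) ⟨
            prod B · prod (A ++ Zs)     ∎)
        where
        open ≋-Reasoning
        A B : List Ideal
        A = take (Fin.toℕ i) Ps
        B = Q ∷ Qs
        primesZ : All NonPrincipalPrime Zs
        primesZ = All.++⁻ʳ B (All.++⁻ʳ A (≡.subst (All NonPrincipalPrime) split primes))
        -- The removed block is nonempty, so at most k of the `suc k` primes remain.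
        short : length (A ++ Zs) ≤ k
        short = ℕ.≤-pred (≡.subst (length (A ++ Zs) <_) (≡.trans (≡.cong length (≡.sym split)) len)
          (length-dropBlock A Q Qs Zs))
        B-principal : IsPrincipal (prod B)
        B-principal = ∼⇒quotient-principal {prod A} {prod (take (Fin.toℕ j) Ps)} {prod B}
          (NonZero-prod (All.take⁺ (Fin.toℕ i) primes)) (class-injective _ _ same) (begin
            prod (take (Fin.toℕ j) Ps)  ≡⟨ ≡.cong prod takeⱼ ⟩
            prod (A ++ B)               ≈⟨ prod-++ A B ⟩
            prod A · prod B             ∎)
        b : Carrier
        b = proj₁ B-principal
        B≋ : prod B ≋ ⟨ b ⟩
        B≋ = proj₂ B-principal

      prime·factorization : ∀ {I P J} → IsPrime P → Factorization k J → I ≋ P · J → Factorization k I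
      prime·factorization {I} {P} {J} isPrime F@(factorization γ Ps primes bounded factors) I≋
        with em₀ {IsPrincipal P}
      ... | yes (π , P≋) = absorb π F P≋ I≋
      ... | no ¬principal = absorb γ rest (M.refl {⟨ γ ⟩}) (begin
            I                        ≈⟨ I≋ ⟩
            P · J                    ≈⟨ M.∙-congˡ factors ⟩
            P · (⟨ γ ⟩ · prod Ps)    ≈⟨ x∙yz≈y∙xz P ⟨ γ ⟩ (prod Ps) ⟩
            ⟨ γ ⟩ · prod (P ∷ Ps)    ∎)
        where
        open ≋-Reasoning
        primes′ : All NonPrincipalPrime (P ∷ Ps)
        primes′ = (isPrime , ¬principal) ∷ primes
        rest : Factorization k (prod (P ∷ Ps))
        rest with ℕ.m≤n⇒m<n∨m≡n bounded
        ... | inj₁ short = factorization-prod (P ∷ Ps) primes′ short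
        -- The list already had k primes, so with P it has exactly the length that `shorten` treats.
        ... | inj₂ full  = shorten (P ∷ Ps) primes′ (≡.cong ℕ.suc full)

      factorize : ∀ {I} → NonZeroIdeal I → Factorization k I
      factorize {I} nz = go nz (⊐-accessible {I} nz)
        where
        go : ∀ {I} → NonZeroIdeal I → Acc _⊐_ I → Factorization k I
        go {I} nz ac@(acc rs) with em₀ {1# ∈ᵢ I}
        ... | yes 1∈I = factorization 1# [] [] z≤n
            (M.trans {I} {unitIdeal} {unitIdeal · unitIdeal} (1∈⇒≋unit I 1∈I)
              (M.sym {unitIdeal · unitIdeal} {unitIdeal} (M.identityˡ unitIdeal)))
        ... | no 1∉I with prime⊒ ac 1∉I
        ... | P , I⊑P , isPrime = prime·factorization {I} {P} {Q} isPrime (go {Q} nzQ (rs {Q} Q⊐I)) I≋PQ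
          where
          quotient : ∃[ Q ] I ≋ P · Q
          quotient = divide {I} {P} (invertible {P} (NonZero-mono {I} {P} I⊑P nz)) I⊑P
          Q : Ideal
          Q = proj₁ quotient
          I≋PQ : I ≋ P · Q
          I≋PQ = proj₂ quotient
          nzQ : NonZeroIdeal Q
          nzQ = NonZero-mono {I} {Q} (·-⊑ʳ P Q ∘ proj₁ I≋PQ) nz
          1∉P : ¬ (1# ∈ᵢ P)
          1∉P = IsPrime.proper isPrime ∘ 1∈⇒≋unit P
          Q⊐I : Q ⊐ I
          Q⊐I = quotient-⊐ {I} {P} {Q} 1∉P (invertible {Q} nzQ) I≋PQ

      factorizeAny : ∀ I → Factorization k I
      factorizeAny I with zero-or-nonZero I
      ... | inj₂ nz  = factorize nz
      -- The zero ideal has no class; it is covered by γ = 0 and the empty product.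
      ... | inj₁ I≋0 = factorization 0# [] [] z≤n
        (M.trans {I} {⟨ 0# ⟩} {⟨ 0# ⟩ · unitIdeal} I≋0
          (M.sym {⟨ 0# ⟩ · unitIdeal} {⟨ 0# ⟩} (M.identityʳ ⟨ 0# ⟩)))

-- Inverses and labels of ideals from the cyclic class group.

module CyclicClasses {c ℓ} (em : ExcludedMiddle (suc (c ⊔ ℓ)))
  (R : CommutativeRing c ℓ) (isDomain : IsDomain R) {k}
  (cyclic : IsCyclicOfOrder
    (CommutativeMonoid.rawMonoid (IdealClasses.idealClassMonoid R isDomain)) (ℕ.suc k))
  where

  open Ideals R
  open IdealArithmetic em R isDomain
  open IdealClasses R isDomain
  private
    module R = CommutativeRing R
    module M = CommutativeMonoid idealMonoid
    module C = CommutativeMonoid idealClassMonoid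

  open IsMonoidIsomorphism (proj₂ (proj₂ cyclic)) using (surjective; homo; ε-homo; ⟦⟧-cong)

  private
    h : ℕ
    h = ℕ.suc k

    f : ℤ → ∃ NonZeroIdeal
    f = proj₁ (proj₂ cyclic)

    -- A discrete logarithm: a chosen integer, meaningful only modulo h.
    index : ∃ NonZeroIdeal → ℤ
    index I = proj₁ (surjective I)

    f-index : ∀ I → f (index I) C.≈ I
    f-index I = proj₂ (surjective I) {index I}
      -- Reflexivity in `ℤ/ h`: h divides the difference 0.
      (≡.subst (+ h ℤ.∣_) (≡.sym (ℤ.+-inverseʳ (index I))) (h ℕ.∣0))

  -- An ideal J in the class of index -i is inverse to I up to `∼`, that is αIJ = `⟨ β ⟩`; moving α
  -- into the partner gives the required form.
  invertible : ∀ {I} → NonZeroIdeal I → Invertible I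
  invertible {I} nz = ⟨ α ⟩ · J , β , β≉0 , I·αJ≋β
    where
    open import Algebra.Properties.CommutativeSemigroup M.commutativeSemigroup using (x∙yz≈y∙xz)
    i : ℤ
    i = index (I , nz)
    J : Ideal
    J = proj₁ (f (ℤ.- i))
    IJ∼unit : (I , nz) C.∙ f (ℤ.- i) C.≈ C.ε
    IJ∼unit = begin
      (I , nz) C.∙ f (ℤ.- i)  ≈⟨ C.∙-congʳ {f (ℤ.- i)} {f i} {I , nz} (f-index (I , nz)) ⟨
      f i C.∙ f (ℤ.- i)       ≈⟨ homo i (ℤ.- i) ⟨
      f (i ℤ.- i)             ≡⟨ ≡.cong f (ℤ.+-inverseʳ i) ⟩
      f ℤ.0ℤ                  ≈⟨ ε-homo ⟩
      C.ε                     ∎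
      where open SetoidReasoning C.setoid
    α β : R.Carrier
    α = proj₁ IJ∼unit
    β = proj₁ (proj₂ IJ∼unit)
    β≉0 : ¬ (β R.≈ R.0#)
    β≉0 = proj₁ (proj₂ (proj₂ (proj₂ IJ∼unit)))
    I·αJ≋β : I · (⟨ α ⟩ · J) ≋ ⟨ β ⟩
    I·αJ≋β = begin
      I · (⟨ α ⟩ · J)     ≈⟨ x∙yz≈y∙xz I ⟨ α ⟩ J ⟩
      ⟨ α ⟩ · (I · J)     ≈⟨ proj₂ (proj₂ (proj₂ (proj₂ IJ∼unit))) ⟩
      ⟨ β ⟩ · unitIdeal   ≈⟨ M.identityʳ ⟨ β ⟩ ⟩
      ⟨ β ⟩               ∎
      where open SetoidReasoning M.setoid

  class : ∃ NonZeroIdeal → Fin (ℕ.suc k)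
  class I = Fin.fromℕ< (ℤ.n%ℕd<d (index I) h)

  -- Equal remainders make the two indices equal in `ℤ/ h`, and f sends equal indices to equivalent
  -- ideals.
  class-injective : ∀ I J → class I ≡ class J → proj₁ I ∼ proj₁ J
  class-injective I J same = C.trans {I} {f (index I)} {J} (C.sym {f (index I)} {I} (f-index I))
    (C.trans {f (index I)} {f (index J)} {J}
      (⟦⟧-cong (%ℕ-injective-mod h (index I) (index J)
        (Fin.fromℕ<-injective _ _ (ℤ.n%ℕd<d (index I) h) (ℤ.n%ℕd<d (index J) h) same)))
      (f-index J))

  factorizeDistinct : (I : Ideal) →
    Σ[ γ ∈ R.Carrier ]
    Σ[ m ∈ ℕ ]
    Σ[ T ∈ (Fin m → Ideal) ]
    Σ[ e ∈ (Fin m → ℕ) ]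
      1 ≤ m ×
      Injective _≡_ _≋_ T ×
      sum +-*-semiring e ≤ k ×
      I ≋ ⟨ γ ⟩ · ∏ (λ i → T i ^ᵢ e i) ×
      (∀ i → (IsPrime (T i) × ¬ IsPrincipal (T i)) ⊎ T i ≋ unitIdeal)
  factorizeDistinct I =
    γ , m , T , e , nonempty , injective , ≡.subst (_≤ k) (≡.sym degree) bounded , I≋ , allowed
    where
    open Factorization (factorizeAny invertible class class-injective I) renaming (factors to I≋γPs)
    open DistinctPowers (collect primes)
    open SetoidReasoning M.setoid
    I≋ : I ≋ ⟨ γ ⟩ · ∏ (λ i → T i ^ᵢ e i)
    I≋ = begin
      I                                ≈⟨ I≋γPs ⟩
      ⟨ γ ⟩ · prod Ps                  ≈⟨ M.∙-congˡ {⟨ γ ⟩} {prod Ps} {∏ (λ i → T i ^ᵢ e i)} factors ⟩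
      ⟨ γ ⟩ · ∏ (λ i → T i ^ᵢ e i)     ∎

theorem1 : ∀ {c ℓ₁ ℓ₂} → ExcludedMiddle (suc (c ⊔ ℓ₁ ⊔ ℓ₂)) →
    (K : NumberField c ℓ₁ ℓ₂) →
    let open Ideals (𝓞 K) in
    (I : Ideal) (h : ℕ) → IsCyclicOfOrder (ClassGroup K) h →
    Σ[ γ ∈ CommutativeRing.Carrier (𝓞 K) ]
    Σ[ m ∈ ℕ ]
    Σ[ T ∈ (Fin m → Ideal) ]
    Σ[ e ∈ (Fin m → ℕ) ]
    1 ≤ m ×
    Injective _≡_ _≋_ T ×
    sum +-*-semiring e ≤ h ∸ 1 ×
    I ≋ ⟨ γ ⟩ · ∏ (λ i → T i ^ᵢ e i) ×
    (∀ i → (IsPrime (T i) × ¬ IsPrincipal (T i)) ⊎ T i ≋ unitIdeal)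
-- A cyclic group of finite order has nonzero h, so only `suc k` remains, where `h ∸ 1` computes to
-- k.
theorem1 em K I ℕ.zero    (() , _)
theorem1 {c} {ℓ₁} {ℓ₂} em K I (ℕ.suc k) cyclic =
  CyclicClasses.factorizeDistinct (lowerEM (suc (c ⊔ ℓ₁ ⊔ ℓ₂)) em) (𝓞 K) (𝓞-isDomain K) cyclic I
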